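{- Let $\mathcal A$ be a class of function algebras. The class of provably total functions of the recursive arithmetic $\mathcal A\mathsf{RA}_1$ is exactly the class of functions $f\colon\mathbb N\times 2^{\mathbb N}\to\mathbb N$ for which there is a derivation $d$ in $\mathcal A$ such that for every $X\subseteq\mathbb N$ the standard model $(\mathbb N,X,\vec f)$ of $\mathcal A\mathsf{RA}_1$ satisfies $f_d(x)=f(x,X)$ for all $x\in\mathbb N$.
   Context: **Language $L_1$ and BASIC.** $L_1$ is the first-order language with constant $0$, unary function symbols $S,H,T$, binary function symbols $+,\cdot$, a binary pairing function symbol $(\cdot,\cdot)$, and a binary relation $<$. Write $1=S(0)$, $2=S(S(0))$, and $x\le y$ for $x<y\lor x=y$. Pairing associates to the right, and $f(x,y)$ means $f((x,y))$. BASIC consists of the universal closures of: $S(x)\neq 0$; $S(x)=S(y)\to x=y$; $x+0=x$; $x+S(y)=S(x+y)$; $x\cdot 0=0$; $x\cdot S(y)=x\cdot y+x$; $\lnot x<0$; $x<S(y)\leftrightarrow x<y\lor x=y$; $x<y\lor x=y\lor y<x$; $0<x\to\exists y<x\,S(y)=x$; $(x,y)=z\leftrightarrow 2\cdot z=(x+y)\cdot(x+y+1)+2\cdot x+2$; $(x,y)=(x',y')\to x=x'\land y=y'$; $z>0\to\exists x,y<z\,(x,y)=z$; $H((x,y))=x$; $H(0)=0$; $T((x,y))=y$; $T(0)=0$. $\mathbb N$ also denotes the standard $L_1$-structure satisfying BASIC. **Functions as sets.** $L_1(X,\vec f)$ is $L_1$ with additional unary predicate symbols ("set constants") $X$ and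 $f_d$ ($d$ a derivation, below); $t\in X$ is written for $X(t)$. For a set $f$, $f\in\mathcal F$ abbreviates $\forall x\exists y\,(x,y)\in f\land\forall x,y,y'((x,y)\in f\land(x,y')\in f\to y=y')\land 0\notin f$; $f(t)=s$ abbreviates $(t,s)\in f$. **Function operators and classes of algebras.** A function operator $f:=\mathrm{op}(g_1,\dots,g_n)$ ($n\ge 0$) is specified by a formula of $L_1$ extended with atomic formulas $t\in Y$ for set variables $Y$, with no free number variables and no set quantifiers, containing exactly the set variables $f,g_1,\dots,g_n$, and which is a universal sentence (the universal closure over number variables of a quantifier-free formula, with $g(t)=s$ read as $(t,s)\in g$). It is required that for all $X\subseteq\mathbb N$ and all $g_1,\dots,g_n\subseteq\mathbb N$ in $\mathcal F$ there is a unique $f\subseteq\mathbb N$ satisfying $f:=\mathrm{op}(g_1,\dots,g_n)$ and $f\in\mathcal F$. Used with set constants in place of set variables, such an operator is a schema. The oracle operator $f:=X_\ast$ is $\forall x((x\in X\to f(x)=1)\land(x\notin X\to f(x)=0))$. A class of function algebras $\mathcal A$ is given by a finite tuple of function operators; it is required throughout that this tuple contains the following operators, each the universal closure of the displayed formula: - $f:=\mathrm S$: $f(x)=S(x)$; - $f:=\oplus$: $f(x,y)=x+y\land f(0)=0$; - $f:=\otimes$: $f(x,y)=x\cdot y\land f(0)=0$; - $f:={<_\ast}$: $(x<y\to f(x,y)=1)\land(x\ge y\to f(x,y)=0)\land f(0)=0$; - $f:=\mathrm I$: $f(x)=x$; - $f:=\mathrm D$: $f(0,y,z)=y\land f(S(x),y,z)=z\land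 f(0)=0\land f(x,0)=0$; - $f:=\mathrm P(g,h)$: $g(x)=v\land h(x)=w\to f(x)=(v,w)$; - $f:=g\circ h$: $h(x)=z\land g(z)=y\to f(x)=y$; - $f:=\mu(g)$: $(f(b,x)=z\to z\le b)\land(f(b,x)=z\land y<b\land g(y,x)=1\to z\le y)\land(f(b,x)=z\land z<b\to g(z,x)=1)\land f(0)=0$. **Derivations, $\mathcal A\mathsf{RA}_1$, standard models.** Derivations in $\mathcal A$ are the least set of formal terms containing the symbol $X_\ast$ and containing $\mathrm{op}(d_1,\dots,d_n)$ for each $n$-ary operator $\mathrm{op}$ of $\mathcal A$ and derivations $d_1,\dots,d_n$. The recursive arithmetic $\mathcal A\mathsf{RA}_1$ is the theory in $L_1(X,\vec f)$ consisting of BASIC, the axioms $f_{X_\ast}:=X_\ast$ and $f_{X_\ast}\in\mathcal F$, and for each operator and derivations $d_1,\dots,d_n$ the axioms $f_{\mathrm{op}(d_1,\dots,d_n)}:=\mathrm{op}(f_{d_1},\dots,f_{d_n})$ and $f_{\mathrm{op}(d_1,\dots,d_n)}\in\mathcal F$. For each $X\subseteq\mathbb N$ the structure $(\mathbb N,X)$ expands uniquely to a model $(\mathbb N,X,\vec f)$ of $\mathcal A\mathsf{RA}_1$, called a standard model. **Provably total functions.** A provably total function of $\mathcal A\mathsf{RA}_1$ is a function $f\colon\mathbb N\times 2^{\mathbb N}\to\mathbb N$ for which there is a $\Sigma^0_1$ formula $\varphi(x,y)$ of $L_1(X,\vec f)$ (existential number quantifiers followed by a bounded formula, in which $X$ and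 $\vec f$ may occur) without parameters such that (a) $\mathcal A\mathsf{RA}_1\vdash\forall x\exists!y\,\varphi(x,y)$ and (b) for all $X\subseteq\mathbb N$ and $x\in\mathbb N$ the standard model $(\mathbb N,X,\vec f)$ satisfies $\varphi(x,f(x,X))$. -}

module Defs where

open import Data.Bool using (Bool; true; false; if_then_else_)
open import Data.Bool.Properties using (⇔→≡)
open import Data.Empty using (⊥; ⊥-elim)
open import Data.Fin using (Fin; zero; suc)
open import Data.Fin.Patterns using (0F; 1F; 2F; 3F)
open import Data.List using (List; []; _∷_)
open import Data.List.Membership.Propositional using (_∈_)
open import Data.List.Relation.Binary.Subset.Propositional using (_⊆_)
open import Data.List.Relation.Unary.All using (All)
import Data.List as List
import Data.List.Relation.Unary.All as All
open import Data.Nat as ℕ using (ℕ; zero; suc)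
open import Data.Nat.Properties as ℕₚ using ()
open import Data.Nat.Tactic.RingSolver using (solve-∀)
open import Data.Product using (Σ; ∃; ∃-syntax; ∃!; _×_; _,_; proj₁; proj₂)
open import Data.Sum using (_⊎_; inj₁; inj₂)
open import Data.Unit using (⊤; tt)
open import Data.Vec using (Vec; []; _∷_; lookup)
open import Function using (_∘_; id; mk⇔)
open import Relation.Binary.Definitions using (tri<; tri≈; tri>)
open import Relation.Binary.PropositionalEquality
  using (_≡_; _≗_; refl; sym; trans; cong; cong₂; subst; module ≡-Reasoning)
open import Relation.Nullary using (¬_)
open import Relation.Nullary.Decidable using (⌊_⌋; yes; no)

-- Formulas are those of L₁ extended by unary predicate symbols from P, which
-- play the role of set variables or set constants;  t ∈ₛ p  is the atom  p(t).
-- Variables are de Bruijn indices.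

data Term (n : ℕ) : Set where
  var       : Fin n → Term n
  O         : Term n
  S H T     : Term n → Term n
  _⊕_ _⊗_   : Term n → Term n → Term n
  ⟨_,_⟩     : Term n → Term n → Term n

infixl 8 _⊗_
infixl 7 _⊕_
infix  6 _≐_ _≺_ _≼_ _∈ₛ_ _⦅_⦆≐_
infix  5 ∼_
infixr 4 _∧_
infixr 3 _∨_
infixr 2 _⇒_ _⇔′_

data Formula (P : Set) (n : ℕ) : Set where
  ⊥′          : Formula P n
  _≐_ _≺_     : Term n → Term n → Formula P n
  _∈ₛ_        : Term n → P → Formula P n
  _⇒_ _∧_ _∨_ : Formula P n → Formula P n → Formula P n
  ∀′ ∃′       : Formula P (suc n) → Formula P n

private variable
  P Q : Set
  m n : ℕ

subT : (Fin m → Term n) → Term m → Term n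
subT σ (var i)   = σ i
subT σ O         = O
subT σ (S t)     = S (subT σ t)
subT σ (H t)     = H (subT σ t)
subT σ (T t)     = T (subT σ t)
subT σ (s ⊕ t)   = subT σ s ⊕ subT σ t
subT σ (s ⊗ t)   = subT σ s ⊗ subT σ t
subT σ ⟨ s , t ⟩ = ⟨ subT σ s , subT σ t ⟩

wkT : Term n → Term (suc n)
wkT = subT (var ∘ suc)

lift : (Fin m → Term n) → Fin (suc m) → Term (suc n)
lift σ zero    = var zero
lift σ (suc i) = wkT (σ i)

sub : (Fin m → Term n) → Formula P m → Formula P n
sub σ ⊥′       = ⊥′
sub σ (s ≐ t)  = subT σ s ≐ subT σ t
sub σ (s ≺ t)  = subT σ s ≺ subT σ t
sub σ (t ∈ₛ p) = subT σ t ∈ₛ p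
sub σ (φ ⇒ ψ)  = sub σ φ ⇒ sub σ ψ
sub σ (φ ∧ ψ)  = sub σ φ ∧ sub σ ψ
sub σ (φ ∨ ψ)  = sub σ φ ∨ sub σ ψ
sub σ (∀′ φ)   = ∀′ (sub (lift σ) φ)
sub σ (∃′ φ)   = ∃′ (sub (lift σ) φ)

wk : Formula P n → Formula P (suc n)
wk = sub (var ∘ suc)

embed : Formula P 0 → Formula P n
embed = sub λ ()

inst : Term n → Fin (suc n) → Term n
inst t zero    = t
inst t (suc i) = var i

infix 9 _[_]
_[_] : Formula P (suc n) → Term n → Formula P n
φ [ t ] = sub (inst t) φ

mapP : (P → Q) → Formula P n → Formula Q n
mapP f ⊥′       = ⊥′
mapP f (s ≐ t)  = s ≐ t
mapP f (s ≺ t)  = s ≺ t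
mapP f (t ∈ₛ p) = t ∈ₛ f p
mapP f (φ ⇒ ψ)  = mapP f φ ⇒ mapP f ψ
mapP f (φ ∧ ψ)  = mapP f φ ∧ mapP f ψ
mapP f (φ ∨ ψ)  = mapP f φ ∨ mapP f ψ
mapP f (∀′ φ)   = ∀′ (mapP f φ)
mapP f (∃′ φ)   = ∃′ (mapP f φ)

closure : Formula P n → Formula P 0
closure {n = zero}  φ = φ
closure {n = suc n} φ = closure (∀′ φ)

∼_ : Formula P n → Formula P n
∼ φ = φ ⇒ ⊥′

_⇔′_ : Formula P n → Formula P n → Formula P n
φ ⇔′ ψ = (φ ⇒ ψ) ∧ (ψ ⇒ φ)

_≼_ : Term n → Term n → Formula P n
s ≼ t = s ≺ t ∨ s ≐ t

∀< ∃< : Term n → Formula P (suc n) → Formula P n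
∀< t φ = ∀′ (var 0F ≺ wkT t ⇒ φ)
∃< t φ = ∃′ (var 0F ≺ wkT t ∧ φ)

-- p ⦅ t ⦆≐ s  is  "p(t) = s".
_⦅_⦆≐_ : P → Term n → Term n → Formula P n
p ⦅ t ⦆≐ s = ⟨ t , s ⟩ ∈ₛ p

one two : Term n
one = S O
two = S (S O)

QuantifierFree : Formula P n → Set
QuantifierFree ⊥′       = ⊤
QuantifierFree (s ≐ t)  = ⊤
QuantifierFree (s ≺ t)  = ⊤
QuantifierFree (t ∈ₛ p) = ⊤
QuantifierFree (φ ⇒ ψ)  = QuantifierFree φ × QuantifierFree ψ
QuantifierFree (φ ∧ ψ)  = QuantifierFree φ × QuantifierFree ψ
QuantifierFree (φ ∨ ψ)  = QuantifierFree φ × QuantifierFree ψ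
QuantifierFree (∀′ φ)   = ⊥
QuantifierFree (∃′ φ)   = ⊥

Occurs : P → Formula P n → Set
Occurs p ⊥′       = ⊥
Occurs p (s ≐ t)  = ⊥
Occurs p (s ≺ t)  = ⊥
Occurs p (t ∈ₛ q) = p ≡ q
Occurs p (φ ⇒ ψ)  = Occurs p φ ⊎ Occurs p ψ
Occurs p (φ ∧ ψ)  = Occurs p φ ⊎ Occurs p ψ
Occurs p (φ ∨ ψ)  = Occurs p φ ⊎ Occurs p ψ
Occurs p (∀′ φ)   = Occurs p φ
Occurs p (∃′ φ)   = Occurs p φ

data Bounded {P : Set} {n : ℕ} : Formula P n → Set where
  ⊥′   : Bounded ⊥′
  _≐_  : ∀ s t → Bounded (s ≐ t)
  _≺_  : ∀ s t → Bounded (s ≺ t)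
  _∈ₛ_ : ∀ t p → Bounded (t ∈ₛ p)
  _⇒_  : ∀ {φ ψ} → Bounded φ → Bounded ψ → Bounded (φ ⇒ ψ)
  _∧_  : ∀ {φ ψ} → Bounded φ → Bounded ψ → Bounded (φ ∧ ψ)
  _∨_  : ∀ {φ ψ} → Bounded φ → Bounded ψ → Bounded (φ ∨ ψ)
  ∀<ᵇ  : ∀ t {φ} → Bounded φ → Bounded (∀< t φ)
  ∃<ᵇ  : ∀ t {φ} → Bounded φ → Bounded (∃< t φ)

data Σ⁰₁ {P : Set} {n : ℕ} : Formula P n → Set where
  bounded : ∀ {φ} → Bounded φ → Σ⁰₁ φ
  ∃′      : ∀ {φ} → Σ⁰₁ φ → Σ⁰₁ (∃′ φ)

-- Classical natural deduction with equality, from a set Th of sentences.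

infix 1 _∣_⊢_

data _∣_⊢_ {P : Set} (Th : Formula P 0 → Set) {n : ℕ}
           (Γ : List (Formula P n)) : Formula P n → Set where
  ax   : ∀ {φ} → Th φ → Th ∣ Γ ⊢ embed φ
  hyp  : ∀ {φ} → φ ∈ Γ → Th ∣ Γ ⊢ φ
  raa  : ∀ {φ} → Th ∣ (∼ φ) ∷ Γ ⊢ ⊥′ → Th ∣ Γ ⊢ φ
  ⇒I   : ∀ {φ ψ} → Th ∣ φ ∷ Γ ⊢ ψ → Th ∣ Γ ⊢ φ ⇒ ψ
  ⇒E   : ∀ {φ ψ} → Th ∣ Γ ⊢ φ ⇒ ψ → Th ∣ Γ ⊢ φ → Th ∣ Γ ⊢ ψ
  ∧I   : ∀ {φ ψ} → Th ∣ Γ ⊢ φ → Th ∣ Γ ⊢ ψ → Th ∣ Γ ⊢ φ ∧ ψ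
  ∧E₁  : ∀ {φ ψ} → Th ∣ Γ ⊢ φ ∧ ψ → Th ∣ Γ ⊢ φ
  ∧E₂  : ∀ {φ ψ} → Th ∣ Γ ⊢ φ ∧ ψ → Th ∣ Γ ⊢ ψ
  ∨I₁  : ∀ {φ ψ} → Th ∣ Γ ⊢ φ → Th ∣ Γ ⊢ φ ∨ ψ
  ∨I₂  : ∀ {φ ψ} → Th ∣ Γ ⊢ ψ → Th ∣ Γ ⊢ φ ∨ ψ
  ∨E   : ∀ {φ ψ χ} → Th ∣ Γ ⊢ φ ∨ ψ →
         Th ∣ φ ∷ Γ ⊢ χ → Th ∣ ψ ∷ Γ ⊢ χ → Th ∣ Γ ⊢ χ
  ∀I   : ∀ {φ} → Th ∣ List.map wk Γ ⊢ φ → Th ∣ Γ ⊢ ∀′ φ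
  ∀E   : ∀ {φ} → Th ∣ Γ ⊢ ∀′ φ → ∀ t → Th ∣ Γ ⊢ φ [ t ]
  ∃I   : ∀ {φ} t → Th ∣ Γ ⊢ φ [ t ] → Th ∣ Γ ⊢ ∃′ φ
  ∃E   : ∀ {φ ψ} → Th ∣ Γ ⊢ ∃′ φ →
         Th ∣ φ ∷ List.map wk Γ ⊢ wk ψ → Th ∣ Γ ⊢ ψ
  ≐I   : ∀ {t} → Th ∣ Γ ⊢ t ≐ t
  ≐E   : ∀ {s t} φ → Th ∣ Γ ⊢ s ≐ t → Th ∣ Γ ⊢ φ [ s ] → Th ∣ Γ ⊢ φ [ t ]

_⊢_ : (Formula P 0 → Set) → Formula P 0 → Set
Th ⊢ φ = Th ∣ [] ⊢ φ

private
  x : Term (1 ℕ.+ n)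
  x = var 0F
  y : Term (2 ℕ.+ n)
  y = var 1F
  z : Term (3 ℕ.+ n)
  z = var 2F
  w : Term (4 ℕ.+ n)
  w = var 3F

-- Under  ∃<  the new variable is  var 0F  and the outer ones are shifted.
data BASIC {P : Set} : Formula P 0 → Set where
  S≠0      : BASIC (closure {n = 1} (∼ S x ≐ O))
  S-inj    : BASIC (closure {n = 2} (S x ≐ S y ⇒ x ≐ y))
  +0       : BASIC (closure {n = 1} (x ⊕ O ≐ x))
  +S       : BASIC (closure {n = 2} (x ⊕ S y ≐ S (x ⊕ y)))
  ·0       : BASIC (closure {n = 1} (x ⊗ O ≐ O))
  ·S       : BASIC (closure {n = 2} (x ⊗ S y ≐ x ⊗ y ⊕ x))
  ≮0       : BASIC (closure {n = 1} (∼ x ≺ O))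
  <S       : BASIC (closure {n = 2} (x ≺ S y ⇔′ x ≺ y ∨ x ≐ y))
  trich    : BASIC (closure {n = 2} (x ≺ y ∨ x ≐ y ∨ y ≺ x))
  pred     : BASIC (closure {n = 1} (O ≺ x ⇒ ∃< x (S (var 0F) ≐ var 1F)))
  pair-def : BASIC (closure {n = 3}
               (⟨ x , y ⟩ ≐ z ⇔′
                two ⊗ z ≐ (x ⊕ y) ⊗ (x ⊕ y ⊕ one) ⊕ two ⊗ x ⊕ two))
  pair-inj : BASIC (closure {n = 4}
               (⟨ x , y ⟩ ≐ ⟨ z , w ⟩ ⇒ x ≐ z ∧ y ≐ w))
  pair-sur : BASIC (closure {n = 1}
               (O ≺ x ⇒ ∃< x (∃< (var 1F) (⟨ var 1F , var 0F ⟩ ≐ var 2F))))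
  H-pair   : BASIC (closure {n = 2} (H ⟨ x , y ⟩ ≐ x))
  H-0      : BASIC (H O ≐ O)
  T-pair   : BASIC (closure {n = 2} (T ⟨ x , y ⟩ ≐ y))
  T-0      : BASIC (T O ≐ O)

-- "p ∈ 𝓕"
isFunction : P → Formula P 0
isFunction p =
    ∀′ (∃′ (⟨ var 1F , var 0F ⟩ ∈ₛ p))
  ∧ ∀′ (∀′ (∀′ (⟨ var 2F , var 1F ⟩ ∈ₛ p ∧ ⟨ var 2F , var 0F ⟩ ∈ₛ p
                ⇒ var 1F ≐ var 0F)))
  ∧ ∼ O ∈ₛ p

triangle : ℕ → ℕ
triangle zero    = 0
triangle (suc n) = triangle n ℕ.+ suc n

pair : ℕ → ℕ → ℕ
pair a b = suc (triangle (a ℕ.+ b) ℕ.+ a)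

-- Positive numbers enumerate the pairs along the antidiagonals.
nextPair : ℕ × ℕ → ℕ × ℕ
nextPair (a , suc b) = suc a , b
nextPair (a , zero)  = 0 , suc a

unpair : ℕ → ℕ × ℕ
unpair zero          = 0 , 0
unpair (suc zero)    = 0 , 0
unpair (suc (suc n)) = nextPair (unpair (suc n))

fst snd : ℕ → ℕ
fst = proj₁ ∘ unpair
snd = proj₂ ∘ unpair

evalT : Vec ℕ n → Term n → ℕ
evalT ρ (var i)   = lookup ρ i
evalT ρ O         = 0
evalT ρ (S t)     = suc (evalT ρ t)
evalT ρ (H t)     = fst (evalT ρ t)
evalT ρ (T t)     = snd (evalT ρ t)
evalT ρ (s ⊕ t)   = evalT ρ s ℕ.+ evalT ρ t
evalT ρ (s ⊗ t)   = evalT ρ s ℕ.* evalT ρ t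
evalT ρ ⟨ s , t ⟩ = pair (evalT ρ s) (evalT ρ t)

-- Subsets of ℕ are elements of 2^ℕ, that is, characteristic functions.
𝒫ℕ : Set
𝒫ℕ = ℕ → Bool

-- Tarskian satisfaction in the expansion of ℕ by an interpretation of P.
infix 1 _⊨[_]_ _⊨_

_⊨[_]_ : (P → 𝒫ℕ) → Vec ℕ n → Formula P n → Set
I ⊨[ ρ ] ⊥′     = ⊥
I ⊨[ ρ ] s ≐ t  = evalT ρ s ≡ evalT ρ t
I ⊨[ ρ ] s ≺ t  = evalT ρ s ℕ.< evalT ρ t
I ⊨[ ρ ] t ∈ₛ p = I p (evalT ρ t) ≡ true
I ⊨[ ρ ] φ ⇒ ψ  = (I ⊨[ ρ ] φ) → (I ⊨[ ρ ] ψ)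
I ⊨[ ρ ] φ ∧ ψ  = (I ⊨[ ρ ] φ) × (I ⊨[ ρ ] ψ)
I ⊨[ ρ ] φ ∨ ψ  = (I ⊨[ ρ ] φ) ⊎ (I ⊨[ ρ ] ψ)
I ⊨[ ρ ] ∀′ φ   = (a : ℕ) → I ⊨[ a ∷ ρ ] φ
I ⊨[ ρ ] ∃′ φ   = Σ ℕ λ a → I ⊨[ a ∷ ρ ] φ

_⊨_ : (P → 𝒫ℕ) → Formula P 0 → Set
I ⊨ φ = I ⊨[ [] ] φ

_∈𝓕 : 𝒫ℕ → Set
f ∈𝓕 = (λ (_ : ⊤) → f) ⊨ isFunction tt

-- The set variables of an n-ary operator  f := op(g₁,…,gₙ).
data SetVar (n : ℕ) : Set where
  f : SetVar n
  g : Fin n → SetVar n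

record Operator : Set where
  constructor operator
  field
    arity  : ℕ
    nvars  : ℕ
    matrix : Formula (SetVar arity) nvars

  sentence : Formula (SetVar arity) 0
  sentence = closure matrix

  assign : ∀ {A : Set} → A → (Fin arity → A) → SetVar arity → A
  assign a as f     = a
  assign a as (g i) = as i

open Operator public

Satisfies : (o : Operator) → 𝒫ℕ → (Fin (arity o) → 𝒫ℕ) → Set
Satisfies o F G = assign o F G ⊨ sentence o

record IsFunctionOperator (o : Operator) : Set where
  field
    quantifierFree : QuantifierFree (matrix o)
    occurs         : ∀ v → Occurs v (matrix o)
    uniqueSolution : (G : Fin (arity o) → 𝒫ℕ) → (∀ i → G i ∈𝓕) →
                     ∃! _≗_ λ F → Satisfies o F G × F ∈𝓕

open IsFunctionOperator public

S-op ⊕-op ⊗-op <-op I-op D-op P-op ∘-op μ-op : Operator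

S-op = operator 0 1 (f ⦅ x ⦆≐ S x)

⊕-op = operator 0 2 (f ⦅ ⟨ x , y ⟩ ⦆≐ (x ⊕ y) ∧ f ⦅ O ⦆≐ O)

⊗-op = operator 0 2 (f ⦅ ⟨ x , y ⟩ ⦆≐ (x ⊗ y) ∧ f ⦅ O ⦆≐ O)

<-op = operator 0 2 ( (x ≺ y ⇒ f ⦅ ⟨ x , y ⟩ ⦆≐ one)
                    ∧ (y ≼ x ⇒ f ⦅ ⟨ x , y ⟩ ⦆≐ O)
                    ∧ f ⦅ O ⦆≐ O )

I-op = operator 0 1 (f ⦅ x ⦆≐ x)

D-op = operator 0 3 ( f ⦅ ⟨ O , ⟨ y , z ⟩ ⟩ ⦆≐ y
                    ∧ f ⦅ ⟨ S x , ⟨ y , z ⟩ ⟩ ⦆≐ z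
                    ∧ f ⦅ O ⦆≐ O
                    ∧ f ⦅ ⟨ x , O ⟩ ⦆≐ O )

P-op = operator 2 3 ( g 0F ⦅ x ⦆≐ v ∧ g 1F ⦅ x ⦆≐ u ⇒ f ⦅ x ⦆≐ ⟨ v , u ⟩ )
  where
  v u : Term 3
  v = var 1F
  u = var 2F

∘-op = operator 2 3 ( g 1F ⦅ x ⦆≐ z ∧ g 0F ⦅ z ⦆≐ y ⇒ f ⦅ x ⦆≐ y )

μ-op = operator 1 4
  ( (f ⦅ ⟨ b , x ⟩ ⦆≐ z ⇒ z ≼ b)
  ∧ (f ⦅ ⟨ b , x ⟩ ⦆≐ z ∧ y ≺ b ∧ g 0F ⦅ ⟨ y , x ⟩ ⦆≐ one ⇒ z ≼ y)
  ∧ (f ⦅ ⟨ b , x ⟩ ⦆≐ z ∧ z ≺ b ⇒ g 0F ⦅ ⟨ z , x ⟩ ⦆≐ one)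
  ∧ f ⦅ O ⦆≐ O )
  where
  b : Term 4
  b = var 3F

requiredOperators : List Operator
requiredOperators =
  S-op ∷ ⊕-op ∷ ⊗-op ∷ <-op ∷ I-op ∷ D-op ∷ P-op ∷ ∘-op ∷ μ-op ∷ []

record ClassOfFunctionAlgebras : Set where
  field
    operators        : List Operator
    areOperators     : All IsFunctionOperator operators
    containsRequired : requiredOperators ⊆ operators

open ClassOfFunctionAlgebras public

data Derivation (𝓐 : ClassOfFunctionAlgebras) : Set where
  X⋆ : Derivation 𝓐
  op : ∀ {o} → o ∈ operators 𝓐 → Vec (Derivation 𝓐) (arity o) → Derivation 𝓐

data SetConstant (𝓐 : ClassOfFunctionAlgebras) : Set where
  X    : SetConstant 𝓐
  f⟨_⟩ : Derivation 𝓐 → SetConstant 𝓐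

data RA₁ (𝓐 : ClassOfFunctionAlgebras) : Formula (SetConstant 𝓐) 0 → Set where
  basic    : ∀ {φ} → BASIC φ → RA₁ 𝓐 φ
  oracle   : RA₁ 𝓐 (closure {n = 1} ( (x ∈ₛ X ⇒ f⟨ X⋆ ⟩ ⦅ x ⦆≐ one)
                                    ∧ (∼ x ∈ₛ X ⇒ f⟨ X⋆ ⟩ ⦅ x ⦆≐ O) ))
  operator : ∀ {o} (o∈ : o ∈ operators 𝓐) ds →
             RA₁ 𝓐 (mapP (assign o f⟨ op o∈ ds ⟩ (λ i → f⟨ lookup ds i ⟩))
                         (sentence o))
  function : ∀ d → RA₁ 𝓐 (isFunction f⟨ d ⟩)

graph : (ℕ → ℕ) → 𝒫ℕ
graph h zero    = false
graph h (suc k) = ⌊ h (fst (suc k)) ℕ.≟ snd (suc k) ⌋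

pair-suc : ∀ a b → pair (suc a) b ≡ suc (pair a (suc b))
pair-suc a b rewrite ℕₚ.+-suc a b = cong suc (ℕₚ.+-suc (triangle (suc (a ℕ.+ b))) a)

pair-zero : ∀ b → pair 0 (suc b) ≡ suc (pair b 0)
pair-zero b
  rewrite ℕₚ.+-identityʳ b | ℕₚ.+-identityʳ (triangle b ℕ.+ suc b) =
  cong suc (ℕₚ.+-suc (triangle b) b)

unpair-pair : ∀ a b → unpair (pair a b) ≡ (a , b)
unpair-pair a b = go _ a b refl
  where
  go : ∀ s a b → a ℕ.+ b ≡ s → unpair (pair a b) ≡ (a , b)
  go zero    zero    zero    eq = refl
  go (suc s) zero    (suc b) eq = trans (cong unpair (pair-zero b))
    (cong nextPair (go s b zero (trans (ℕₚ.+-identityʳ b) (ℕₚ.suc-injective eq))))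
  go s       (suc a) b       eq = trans (cong unpair (pair-suc a b))
    (cong nextPair (go s a (suc b) (trans (ℕₚ.+-suc a b) eq)))

fst-pair : ∀ a b → fst (pair a b) ≡ a
fst-pair a b = cong proj₁ (unpair-pair a b)

snd-pair : ∀ a b → snd (pair a b) ≡ b
snd-pair a b = cong proj₂ (unpair-pair a b)

pair-nextPair : ∀ p → let a , b = nextPair p in
                pair a b ≡ suc (pair (proj₁ p) (proj₂ p))
pair-nextPair (a , zero)  = pair-zero a
pair-nextPair (a , suc b) = pair-suc a b

pair-unpair : ∀ k → pair (fst (suc k)) (snd (suc k)) ≡ suc k
pair-unpair zero    = refl
pair-unpair (suc k) =
  trans (pair-nextPair (unpair (suc k))) (cong suc (pair-unpair k))

triangle-double : ∀ n → 2 ℕ.* triangle n ≡ n ℕ.* (n ℕ.+ 1)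
triangle-double zero    = refl
triangle-double (suc n) = begin
  2 ℕ.* (triangle n ℕ.+ suc n)            ≡⟨ ℕₚ.*-distribˡ-+ 2 (triangle n) (suc n) ⟩
  2 ℕ.* triangle n ℕ.+ 2 ℕ.* suc n        ≡⟨ cong (ℕ._+ 2 ℕ.* suc n) (triangle-double n) ⟩
  n ℕ.* (n ℕ.+ 1) ℕ.+ 2 ℕ.* suc n         ≡⟨ arith n ⟩
  suc n ℕ.* (suc n ℕ.+ 1)                 ∎
  where
  open ≡-Reasoning
  arith : ∀ n → n ℕ.* (n ℕ.+ 1) ℕ.+ 2 ℕ.* (1 ℕ.+ n) ≡ (1 ℕ.+ n) ℕ.* (1 ℕ.+ n ℕ.+ 1)
  arith = solve-∀

pair-double : ∀ a b → 2 ℕ.* pair a b ≡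
              (a ℕ.+ b) ℕ.* (a ℕ.+ b ℕ.+ 1) ℕ.+ 2 ℕ.* a ℕ.+ 2
pair-double a b = trans (arith (triangle (a ℕ.+ b)) a)
  (cong (λ k → k ℕ.+ 2 ℕ.* a ℕ.+ 2) (triangle-double (a ℕ.+ b)))
  where
  arith : ∀ t a → 2 ℕ.* (1 ℕ.+ (t ℕ.+ a)) ≡ 2 ℕ.* t ℕ.+ 2 ℕ.* a ℕ.+ 2
  arith = solve-∀

n≤triangle : ∀ n → n ℕ.≤ triangle n
n≤triangle zero    = ℕ.z≤n
n≤triangle (suc n) = ℕₚ.m≤n+m (suc n) (triangle n)

fst<pair : ∀ a b → a ℕ.< pair a b
fst<pair a b = ℕ.s≤s (ℕₚ.m≤n+m a (triangle (a ℕ.+ b)))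

snd<pair : ∀ a b → b ℕ.< pair a b
snd<pair a b = ℕ.s≤s (ℕₚ.≤-trans (ℕₚ.m≤n+m b a)
  (ℕₚ.≤-trans (n≤triangle (a ℕ.+ b)) (ℕₚ.m≤m+n _ a)))

ℕ⊨BASIC : {I : P → 𝒫ℕ} {φ : Formula P 0} → BASIC φ → I ⊨ φ
ℕ⊨BASIC S≠0   a       = λ ()
ℕ⊨BASIC S-inj b a     = ℕₚ.suc-injective
ℕ⊨BASIC +0 a          = ℕₚ.+-identityʳ a
ℕ⊨BASIC +S b a        = ℕₚ.+-suc a b
ℕ⊨BASIC ·0 a          = ℕₚ.*-zeroʳ a
ℕ⊨BASIC ·S b a        = trans (ℕₚ.*-suc a b) (ℕₚ.+-comm a (a ℕ.* b))
ℕ⊨BASIC ≮0 a          = λ ()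
ℕ⊨BASIC <S b a        =
  (λ a<Sb → ℕₚ.m≤n⇒m<n∨m≡n (ℕ.s≤s⁻¹ a<Sb)) ,
  λ { (inj₁ a<b) → ℕₚ.m<n⇒m<1+n a<b ; (inj₂ refl) → ℕₚ.≤-refl }
ℕ⊨BASIC trich b a     with ℕₚ.<-cmp a b
... | tri< a<b _ _ = inj₁ a<b
... | tri≈ _ a≡b _ = inj₂ (inj₁ a≡b)
... | tri> _ _ b<a = inj₂ (inj₂ b<a)
ℕ⊨BASIC pred (suc a) _ = a , ℕₚ.≤-refl , refl
ℕ⊨BASIC pair-def c b a =
  (λ { refl → pair-double a b }) ,
  λ eq → ℕₚ.*-cancelˡ-≡ (pair a b) c 2 (trans (pair-double a b) (sym eq))
ℕ⊨BASIC pair-inj d c b a eq =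
  trans (sym (fst-pair a b)) (trans (cong fst eq) (fst-pair c d)) ,
  trans (sym (snd-pair a b)) (trans (cong snd eq) (snd-pair c d))
ℕ⊨BASIC pair-sur (suc k) _ =
  fst (suc k) , subst (fst (suc k) ℕ.<_) (pair-unpair k) (fst<pair _ _) ,
  snd (suc k) , subst (snd (suc k) ℕ.<_) (pair-unpair k) (snd<pair (fst (suc k)) _) ,
  pair-unpair k
ℕ⊨BASIC H-pair b a = fst-pair a b
ℕ⊨BASIC H-0        = refl
ℕ⊨BASIC T-pair b a = snd-pair a b
ℕ⊨BASIC T-0        = refl

graph⇐ : ∀ h a → graph h (pair a (h a)) ≡ true
graph⇐ h a rewrite unpair-pair a (h a) with h a ℕ.≟ h a
... | yes _ = refl
... | no ¬p = ⊥-elim (¬p refl)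

graph⇒ : ∀ h a b → graph h (pair a b) ≡ true → h a ≡ b
graph⇒ h a b eq rewrite unpair-pair a b with h a ℕ.≟ b
... | yes p = p

graph∈𝓕 : ∀ h → graph h ∈𝓕
graph∈𝓕 h =
  (λ a → h a , graph⇐ h a) ,
  (λ a b b′ (p , q) → trans (sym (graph⇒ h a b p)) (graph⇒ h a b′ q)) ,
  λ ()

graph-unique : ∀ h {F} → F ∈𝓕 → (∀ a → F (pair a (h a)) ≡ true) → graph h ≗ F
graph-unique h {F} (_ , fun , 0∉F) p zero with F 0
... | false = refl
... | true  = ⊥-elim (0∉F refl)
graph-unique h {F} (_ , fun , 0∉F) p (suc k) = ⇔→≡ {z = true} (mk⇔
  (λ q → trans (cong F (trans (sym (pair-unpair k))
           (cong (pair a) (sym (graph⇒ h a b (trans (cong (graph h) (pair-unpair k)) q))))))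
           (p a))
  (λ q → trans (cong (graph h) (trans (sym (pair-unpair k))
           (cong (pair a) (fun a b (h a) (trans (cong F (pair-unpair k)) q , p a)))))
           (graph⇐ h a)))
  where
  a b : ℕ
  a = fst (suc k)
  b = snd (suc k)

mapP-⊨ : {I : P → 𝒫ℕ} {J : Q → 𝒫ℕ} {σ : P → Q} → (∀ p → I p ≗ J (σ p)) →
         (φ : Formula P n) {ρ : Vec ℕ n} →
         ((I ⊨[ ρ ] φ) → (J ⊨[ ρ ] mapP σ φ)) × ((J ⊨[ ρ ] mapP σ φ) → (I ⊨[ ρ ] φ))
mapP-⊨ e ⊥′       = id , id
mapP-⊨ e (s ≐ t)  = id , id
mapP-⊨ e (s ≺ t)  = id , id
mapP-⊨ e (t ∈ₛ p) = trans (sym (e p _)) , trans (e p _)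
mapP-⊨ e (φ ⇒ ψ)  =
  (λ h q → proj₁ (mapP-⊨ e ψ) (h (proj₂ (mapP-⊨ e φ) q))) ,
  (λ h q → proj₂ (mapP-⊨ e ψ) (h (proj₁ (mapP-⊨ e φ) q)))
mapP-⊨ e (φ ∧ ψ)  =
  (λ (p , q) → proj₁ (mapP-⊨ e φ) p , proj₁ (mapP-⊨ e ψ) q) ,
  (λ (p , q) → proj₂ (mapP-⊨ e φ) p , proj₂ (mapP-⊨ e ψ) q)
mapP-⊨ e (φ ∨ ψ)  =
  (λ { (inj₁ p) → inj₁ (proj₁ (mapP-⊨ e φ) p)
     ; (inj₂ q) → inj₂ (proj₁ (mapP-⊨ e ψ) q) }) ,
  (λ { (inj₁ p) → inj₁ (proj₂ (mapP-⊨ e φ) p)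
     ; (inj₂ q) → inj₂ (proj₂ (mapP-⊨ e ψ) q) })
mapP-⊨ e (∀′ φ)   =
  (λ h a → proj₁ (mapP-⊨ e φ) (h a)) , (λ h a → proj₂ (mapP-⊨ e φ) (h a))
mapP-⊨ e (∃′ φ)   =
  (λ (a , h) → a , proj₁ (mapP-⊨ e φ) h) , (λ (a , h) → a , proj₂ (mapP-⊨ e φ) h)

module _ (𝓐 : ClassOfFunctionAlgebras) (A : 𝒫ℕ) where

  χ : ℕ → ℕ
  χ a = if A a then 1 else 0

  -- The unique solutions of the operators, along the derivation.
  interp  : Derivation 𝓐 → Σ 𝒫ℕ _∈𝓕
  interps : Vec (Derivation 𝓐) n → Fin n → Σ 𝒫ℕ _∈𝓕

  interp X⋆         = graph χ , graph∈𝓕 χ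
  interp (op o∈ ds) =
    let F , (_ , F∈𝓕) , _ =
          uniqueSolution (All.lookup (areOperators 𝓐) o∈)
            (proj₁ ∘ interps ds) (proj₂ ∘ interps ds)
    in F , F∈𝓕

  interps (d ∷ ds) zero    = interp d
  interps (d ∷ ds) (suc i) = interps ds i

  -- The expansion (ℕ, A, f⃗) of (ℕ, A); standardModel-models and
  -- standardModel-unique show that it is the only one satisfying RA₁ 𝓐.
  standardModel : SetConstant 𝓐 → 𝒫ℕ
  standardModel X      = A
  standardModel f⟨ d ⟩ = proj₁ (interp d)

  interps-lookup : (ds : Vec (Derivation 𝓐) n) → ∀ i →
                   interps ds i ≡ interp (lookup ds i)
  interps-lookup (d ∷ ds) zero    = refl
  interps-lookup (d ∷ ds) (suc i) = interps-lookup ds i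

  standardModel-models : ∀ {φ} → RA₁ 𝓐 φ → standardModel ⊨ φ
  standardModel-models (basic b)        = ℕ⊨BASIC b
  standardModel-models oracle a with A a in eq
  ... | true  = (λ _ → subst (λ c → graph χ (pair a (if c then 1 else 0)) ≡ true) eq (graph⇐ χ a))
              , (λ ¬p → ⊥-elim (¬p refl))
  ... | false = (λ ())
              , (λ _ → subst (λ c → graph χ (pair a (if c then 1 else 0)) ≡ true) eq (graph⇐ χ a))
  standardModel-models (operator {o} o∈ ds) =
    let _ , (sat , _) , _ =
          uniqueSolution (All.lookup (areOperators 𝓐) o∈)
            (proj₁ ∘ interps ds) (proj₂ ∘ interps ds)
    in proj₁ (mapP-⊨ (λ { f k → refl
                        ; (g i) k → cong (λ p → proj₁ p k) (interps-lookup ds i) })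
                     (sentence o)) sat
  standardModel-models (function d)     = proj₂ (interp d)

  module _ {M : SetConstant 𝓐 → 𝒫ℕ} (M-X : M X ≗ A)
           (M-models : ∀ {φ} → RA₁ 𝓐 φ → M ⊨ φ) where

    standardModel-unique  : ∀ d → standardModel f⟨ d ⟩ ≗ M f⟨ d ⟩
    standardModel-uniques : (ds : Vec (Derivation 𝓐) n) → ∀ i →
                            proj₁ (interps ds i) ≗ M f⟨ lookup ds i ⟩

    standardModel-unique X⋆ = graph-unique χ (M-models (function X⋆)) holds
      where
      holds : ∀ a → M f⟨ X⋆ ⟩ (pair a (χ a)) ≡ true
      holds a with A a in eq
      ... | true  = proj₁ (M-models oracle a) (trans (M-X a) eq)
      ... | false = proj₂ (M-models oracle a)
                      (λ p → case-false (trans (sym eq) (trans (sym (M-X a)) p)))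
        where
        case-false : false ≡ true → ⊥
        case-false ()
    standardModel-unique (op {o} o∈ ds) =
      let _ , _ , unique =
            uniqueSolution (All.lookup (areOperators 𝓐) o∈)
              (proj₁ ∘ interps ds) (proj₂ ∘ interps ds)
      in unique
           ( proj₂ (mapP-⊨ (λ { f k → refl ; (g i) k → standardModel-uniques ds i k })
                           (sentence o))
                   (M-models (operator o∈ ds))
           , M-models (function (op o∈ ds)))

    standardModel-uniques (d ∷ ds) zero    = standardModel-unique d
    standardModel-uniques (d ∷ ds) (suc i) = standardModel-uniques ds i

-- A formula φ(x, y) has  var 1F = x  and  var 0F = y.

-- ∃!y φ(x, y)  is  ∃y (φ(x, y) ∧ ∀y′ (φ(x, y′) → y′ = y)).
∃!′ : Formula P 2 → Formula P 1
∃!′ φ = ∃′ (φ ∧ ∀′ (sub primed φ ⇒ var 0F ≐ var 1F))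
  where
  primed : Fin 2 → Term 3
  primed 0F = var 0F
  primed 1F = var 2F

ProvablyTotal : ClassOfFunctionAlgebras → (ℕ × 𝒫ℕ → ℕ) → Set
ProvablyTotal 𝓐 h =
  Σ (Formula (SetConstant 𝓐) 2) λ φ →
    Σ⁰₁ φ ×
    (RA₁ 𝓐 ⊢ ∀′ (∃!′ φ)) ×
    (∀ (A : 𝒫ℕ) (a : ℕ) → standardModel 𝓐 A ⊨[ h (a , A) ∷ a ∷ [] ] φ)

ComputedBy : (𝓐 : ClassOfFunctionAlgebras) → Derivation 𝓐 → (ℕ × 𝒫ℕ → ℕ) → Set
ComputedBy 𝓐 d h =
  ∀ (A : 𝒫ℕ) (a : ℕ) →
    standardModel 𝓐 A ⊨[ h (a , A) ∷ a ∷ [] ] (f⟨ d ⟩ ⦅ var 1F ⦆≐ var 0F)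

{-# OPTIONS --safe #-}
module Submission where

-- The graph of f_d is an atomic formula, and totality of f_d is an axiom, so
-- computable functions are provably total.  Conversely, RA₁ has no induction:
-- up to the axioms f_d ∈ 𝓕 it is universal, and a Herbrand-style witness for
-- ∀x∃y φ is extracted by forcing.  Conditions are sets of points (a, A),
-- elements are derivations d, read as the functions (a, A) ↦ f_d(a), and ⊥ is
-- read as "some derivation e satisfies φ(a, f_e(a)) at all points of the
-- condition" (Friedman's A-translation).  The case operator glues such
-- derivations along definable partitions; together with bounded minimisation
-- it shows that bounded formulas are definable and forced exactly where they
-- hold.  A second forcing, over one point, turns the provable uniqueness of y
-- into actual uniqueness, so that the witness found computes h.

open import Defs
open import Data.Bool using (true; false; if_then_else_)
open import Data.Empty using (⊥; ⊥-elim)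
open import Data.Fin using (Fin; zero; suc)
open import Data.Fin.Patterns using (0F; 1F; 2F)
open import Data.List as List using (List; []; _∷_)
open import Data.List.Membership.Propositional using (_∈_)
open import Data.List.Relation.Unary.All as All using (All; []; _∷_)
open import Data.List.Relation.Unary.All.Properties using (map⁺)
open import Data.List.Relation.Unary.Any using (here; there)
open import Data.Nat as ℕ using (ℕ; zero; suc; _<_; _≤_)
import Data.Nat.Properties as ℕₚ
open import Data.Product using (Σ; _×_; _,_; proj₁; proj₂; ∃-syntax)
open import Data.Sum using (_⊎_; inj₁; inj₂)
open import Data.Unit using (⊤; tt)
open import Data.Vec using (Vec; []; _∷_; lookup; map)
open import Data.Vec.Properties using (lookup-map; map-cong; map-∘)
open import Function using (_∘_; id; case_of_)
open import Function.Bundles using (_⇔_; mk⇔)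
open import Level using (0ℓ; Lift; lower)
open import Relation.Binary.PropositionalEquality
  using (_≡_; refl; sym; trans; cong; cong₂; subst; subst₂)
open import Relation.Nullary using (¬_; Dec; yes; no)
open import Relation.Nullary.Decidable using (decidable-stable)
open import Relation.Unary using (Pred; _⊆_; _∩_; ∁)

private variable
  m n : ℕ
  P : Set

evalT-sub : {σ : Fin m → Term n} {ρ : Vec ℕ n} {ρ′ : Vec ℕ m} →
            (∀ i → evalT ρ (σ i) ≡ lookup ρ′ i) →
            ∀ t → evalT ρ (subT σ t) ≡ evalT ρ′ t
evalT-sub e (var i)   = e i
evalT-sub e O         = refl
evalT-sub e (S t)     = cong suc (evalT-sub e t)
evalT-sub e (H t)     = cong fst (evalT-sub e t)
evalT-sub e (T t)     = cong snd (evalT-sub e t)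
evalT-sub e (s ⊕ t)   = cong₂ ℕ._+_ (evalT-sub e s) (evalT-sub e t)
evalT-sub e (s ⊗ t)   = cong₂ ℕ._*_ (evalT-sub e s) (evalT-sub e t)
evalT-sub e ⟨ s , t ⟩ = cong₂ pair (evalT-sub e s) (evalT-sub e t)

evalT-wk : ∀ b (ρ : Vec ℕ n) t → evalT (b ∷ ρ) (wkT t) ≡ evalT ρ t
evalT-wk b ρ = evalT-sub λ i → refl

qf⇒bounded : {φ : Formula P n} → QuantifierFree φ → Bounded φ
qf⇒bounded {φ = ⊥′}     q       = ⊥′
qf⇒bounded {φ = s ≐ t}  q       = s ≐ t
qf⇒bounded {φ = s ≺ t}  q       = s ≺ t
qf⇒bounded {φ = t ∈ₛ p} q       = t ∈ₛ p
qf⇒bounded {φ = φ ⇒ ψ}  (q , r) = qf⇒bounded q ⇒ qf⇒bounded r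
qf⇒bounded {φ = φ ∧ ψ}  (q , r) = qf⇒bounded q ∧ qf⇒bounded r
qf⇒bounded {φ = φ ∨ ψ}  (q , r) = qf⇒bounded q ∨ qf⇒bounded r

mapP-bounded : ∀ {Q} (h : P → Q) {φ : Formula P n} → Bounded φ → Bounded (mapP h φ)
mapP-bounded h ⊥′        = ⊥′
mapP-bounded h (s ≐ t)   = s ≐ t
mapP-bounded h (s ≺ t)   = s ≺ t
mapP-bounded h (t ∈ₛ p)  = t ∈ₛ h p
mapP-bounded h (b ⇒ c)   = mapP-bounded h b ⇒ mapP-bounded h c
mapP-bounded h (b ∧ c)   = mapP-bounded h b ∧ mapP-bounded h c
mapP-bounded h (b ∨ c)   = mapP-bounded h b ∨ mapP-bounded h c
mapP-bounded h (∀<ᵇ t b) = ∀<ᵇ t (mapP-bounded h b)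
mapP-bounded h (∃<ᵇ t b) = ∃<ᵇ t (mapP-bounded h b)

mapP-closure : ∀ {Q} (h : P → Q) (φ : Formula P n) →
               mapP h (closure φ) ≡ closure (mapP h φ)
mapP-closure {n = zero}  h φ = refl
mapP-closure {n = suc n} h φ = mapP-closure h (∀′ φ)

closure-⊨ : {I : P → 𝒫ℕ} (φ : Formula P n) → I ⊨ closure φ → ∀ ρ → I ⊨[ ρ ] φ
closure-⊨ {n = zero}  φ p []      = p
closure-⊨ {n = suc n} φ p (a ∷ ρ) = closure-⊨ (∀′ φ) p ρ a

BASIC-universal : {φ : Formula P 0} → BASIC φ →
                  Σ ℕ λ n → Σ (Formula P n) λ ψ → Bounded ψ × φ ≡ closure ψ
BASIC-universal S≠0      = 1 , _ , qf⇒bounded _ , refl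
BASIC-universal S-inj    = 2 , _ , qf⇒bounded _ , refl
BASIC-universal +0       = 1 , _ , qf⇒bounded _ , refl
BASIC-universal +S       = 2 , _ , qf⇒bounded _ , refl
BASIC-universal ·0       = 1 , _ , qf⇒bounded _ , refl
BASIC-universal ·S       = 2 , _ , qf⇒bounded _ , refl
BASIC-universal ≮0       = 1 , _ , qf⇒bounded _ , refl
BASIC-universal <S       = 2 , _ , qf⇒bounded _ , refl
BASIC-universal trich    = 2 , _ , qf⇒bounded _ , refl
BASIC-universal pred     = 1 , _ , (_ ≺ _ ⇒ ∃<ᵇ _ (_ ≐ _)) , refl
BASIC-universal pair-def = 3 , _ , qf⇒bounded _ , refl
BASIC-universal pair-inj = 4 , _ , qf⇒bounded _ , refl
BASIC-universal pair-sur = 1 , _ , (_ ≺ _ ⇒ ∃<ᵇ _ (∃<ᵇ _ (_ ≐ _))) , refl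
BASIC-universal H-pair   = 2 , _ , qf⇒bounded _ , refl
BASIC-universal H-0      = 0 , _ , qf⇒bounded _ , refl
BASIC-universal T-pair   = 2 , _ , qf⇒bounded _ , refl
BASIC-universal T-0      = 0 , _ , qf⇒bounded _ , refl

indicator-1 : ∀ b → (if b then 1 else 0) ≡ 1 → b ≡ true
indicator-1 true _ = refl

data Indicates (Q : Set) : ℕ → Set where
  true  : Q → Indicates Q 1
  false : ¬ Q → Indicates Q 0

indicates⇒dec : ∀ {Q k} → Indicates Q k → Dec Q
indicates⇒dec (true q)  = yes q
indicates⇒dec (false q) = no q

indicates-1 : ∀ {Q k} → Indicates Q k → k ≡ 1 → Q
indicates-1 (true q) refl = q

indicates-true : ∀ {Q k} → Indicates Q k → Q → k ≡ 1
indicates-true (true _)   q = refl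
indicates-true (false ¬q) q = ⊥-elim (¬q q)

indicates-map : ∀ {Q Q′ k} → (Q → Q′) → (Q′ → Q) → Indicates Q k → Indicates Q′ k
indicates-map to from (true q)   = true (to q)
indicates-map to from (false ¬q) = false (¬q ∘ from)

indicates-false : ∀ {Q k} → Indicates Q k → ¬ Q → k ≡ 0
indicates-false (true q)  ¬q = ⊥-elim (¬q q)
indicates-false (false _) ¬q = refl

module Functions (𝓐 : ClassOfFunctionAlgebras) where

  𝔻 : Set
  𝔻 = Derivation 𝓐

  Point : Set
  Point = ℕ × 𝒫ℕ

  model : Point → SetConstant 𝓐 → 𝒫ℕ
  model (_ , A) = standardModel 𝓐 A

  infix 8 _at_ _at*_

  abstract
    _at_ : 𝔻 → Point → ℕ
    d at (a , A) = proj₁ (proj₁ (proj₂ (interp 𝓐 A d)) a)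

    at-graph : ∀ d a A → standardModel 𝓐 A f⟨ d ⟩ (pair a (d at (a , A))) ≡ true
    at-graph d a A = proj₂ (proj₁ (proj₂ (interp 𝓐 A d)) a)

    at-unique : ∀ d a A {b} → standardModel 𝓐 A f⟨ d ⟩ (pair a b) ≡ true → d at (a , A) ≡ b
    at-unique d a A {b} p =
      proj₁ (proj₂ (proj₂ (interp 𝓐 A d))) a (d at (a , A)) b (at-graph d a A , p)

  _at*_ : Vec 𝔻 n → Point → Vec ℕ n
  ρ at* ω = map (_at ω) ρ

  -- The clause for X⋆ is a dummy: it is not the oracle axiom.
  definingAxiom : 𝔻 → Formula (SetConstant 𝓐) 0
  definingAxiom X⋆             = ∼ ⊥′
  definingAxiom (op {o} o∈ ds) =
    mapP (assign o f⟨ op o∈ ds ⟩ (λ i → f⟨ lookup ds i ⟩)) (sentence o)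

  axiom : ∀ A d → standardModel 𝓐 A ⊨ definingAxiom d
  axiom A X⋆         = id
  axiom A (op o∈ ds) = standardModel-models 𝓐 A (operator o∈ ds)

  infixr 9 _∙_

  sucᵈ addᵈ mulᵈ ltᵈ idᵈ caseᵈ : 𝔻
  sucᵈ  = op (containsRequired 𝓐 (here refl)) []
  addᵈ  = op (containsRequired 𝓐 (there (here refl))) []
  mulᵈ  = op (containsRequired 𝓐 (there (there (here refl)))) []
  ltᵈ   = op (containsRequired 𝓐 (there (there (there (here refl))))) []
  idᵈ   = op (containsRequired 𝓐 (there (there (there (there (here refl)))))) []
  caseᵈ = op (containsRequired 𝓐 (there (there (there (there (there (here refl))))))) []

  pairᵈ _∙_ : 𝔻 → 𝔻 → 𝔻
  pairᵈ d e = op (containsRequired 𝓐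
    (there (there (there (there (there (there (here refl)))))))) (d ∷ e ∷ [])
  d ∙ e     = op (containsRequired 𝓐
    (there (there (there (there (there (there (there (here refl))))))))) (d ∷ e ∷ [])

  μᵈ : 𝔻 → 𝔻
  μᵈ d = op (containsRequired 𝓐
    (there (there (there (there (there (there (there (there (here refl)))))))))) (d ∷ [])

  suc-at : ∀ a A → sucᵈ at (a , A) ≡ suc a
  suc-at a A = at-unique sucᵈ a A (axiom A sucᵈ a)

  add-at : ∀ a b A → addᵈ at (pair a b , A) ≡ a ℕ.+ b
  add-at a b A = at-unique addᵈ (pair a b) A (proj₁ (axiom A addᵈ b a))

  mul-at : ∀ a b A → mulᵈ at (pair a b , A) ≡ a ℕ.* b
  mul-at a b A = at-unique mulᵈ (pair a b) A (proj₁ (axiom A mulᵈ b a))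

  lt-at : ∀ a b A → Indicates (a < b) (ltᵈ at (pair a b , A))
  lt-at a b A with a ℕₚ.<? b
  ... | yes a<b = subst (Indicates _)
                    (sym (at-unique ltᵈ (pair a b) A (proj₁ (axiom A ltᵈ b a) a<b))) (true a<b)
  ... | no  a≮b = subst (Indicates _)
                    (sym (at-unique ltᵈ (pair a b) A (proj₁ (proj₂ (axiom A ltᵈ b a))
                      (ℕₚ.m≤n⇒m<n∨m≡n (ℕₚ.≮⇒≥ a≮b)))))
                    (false a≮b)

  id-at : ∀ a A → idᵈ at (a , A) ≡ a
  id-at a A = at-unique idᵈ a A (axiom A idᵈ a)

  case-zero : ∀ b c A → caseᵈ at (pair 0 (pair b c) , A) ≡ b
  case-zero b c A = at-unique caseᵈ (pair 0 (pair b c)) A (proj₁ (axiom A caseᵈ c b 0))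

  case-suc : ∀ a b c A → caseᵈ at (pair (suc a) (pair b c) , A) ≡ c
  case-suc a b c A = at-unique caseᵈ (pair (suc a) (pair b c)) A
    (proj₁ (proj₂ (axiom A caseᵈ c b a)))

  case-0 : ∀ a A → caseᵈ at (pair a 0 , A) ≡ 0
  case-0 a A = at-unique caseᵈ (pair a 0) A (proj₂ (proj₂ (proj₂ (axiom A caseᵈ 0 0 a))))

  pair-at : ∀ d e a A → pairᵈ d e at (a , A) ≡ pair (d at (a , A)) (e at (a , A))
  pair-at d e a A = at-unique (pairᵈ d e) a A
    (axiom A (pairᵈ d e) (e at (a , A)) (d at (a , A)) a (at-graph d a A , at-graph e a A))

  ∙-at : ∀ d e a A → (d ∙ e) at (a , A) ≡ d at (e at (a , A) , A)
  ∙-at d e a A = at-unique (d ∙ e) a A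
    (axiom A (d ∙ e) (e at (a , A)) (d at (e at (a , A) , A)) a
      (at-graph e a A , at-graph d (e at (a , A)) A))

  ∙pair-at : ∀ d e₁ e₂ a A →
             (d ∙ pairᵈ e₁ e₂) at (a , A) ≡ d at (pair (e₁ at (a , A)) (e₂ at (a , A)) , A)
  ∙pair-at d e₁ e₂ a A =
    trans (∙-at d _ a A) (cong (λ b → d at (b , A)) (pair-at e₁ e₂ a A))

  cond : 𝔻 → 𝔻 → 𝔻 → 𝔻
  cond c d e = caseᵈ ∙ pairᵈ c (pairᵈ d e)

  cond-at : ∀ c d e a A → cond c d e at (a , A) ≡
            caseᵈ at (pair (c at (a , A)) (pair (d at (a , A)) (e at (a , A))) , A)
  cond-at c d e a A = trans (∙pair-at caseᵈ c _ a A)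
    (cong (λ b → caseᵈ at (pair (c at (a , A)) b , A)) (pair-at d e a A))

  cond-zero : ∀ c d e {ω} → c at ω ≡ 0 → cond c d e at ω ≡ d at ω
  cond-zero c d e {a , A} p = trans (cond-at c d e a A)
    (trans (cong (λ b → caseᵈ at (pair b (pair (d at (a , A)) (e at (a , A))) , A)) p)
      (case-zero (d at (a , A)) (e at (a , A)) A))

  cond-suc : ∀ c d e {ω k} → c at ω ≡ suc k → cond c d e at ω ≡ e at ω
  cond-suc c d e {a , A} {k} p = trans (cond-at c d e a A)
    (trans (cong (λ b → caseᵈ at (pair b (pair (d at (a , A)) (e at (a , A))) , A)) p)
      (case-suc k (d at (a , A)) (e at (a , A)) A))

  numeral : ℕ → 𝔻
  numeral zero    = ltᵈ ∙ pairᵈ idᵈ idᵈ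
  numeral (suc k) = sucᵈ ∙ numeral k

  numeral-at : ∀ k ω → numeral k at ω ≡ k
  numeral-at zero    (a , A) = indicates-false
    (subst (Indicates _) (sym (∙pair-at ltᵈ idᵈ idᵈ a A))
      (lt-at (idᵈ at (a , A)) (idᵈ at (a , A)) A))
    (ℕₚ.<-irrefl refl)
  numeral-at (suc k) (a , A) = trans (∙-at sucᵈ (numeral k) a A)
    (trans (suc-at _ A) (cong suc (numeral-at k (a , A))))

  -- With selector 0 or 1, the case operator projects a pair to its components
  -- and sends 0 to 0, just like H and T.
  fstᵈ sndᵈ : 𝔻
  fstᵈ = caseᵈ ∙ pairᵈ (numeral 0) idᵈ
  sndᵈ = caseᵈ ∙ pairᵈ (numeral 1) idᵈ

  selector-at : ∀ k a A → (caseᵈ ∙ pairᵈ (numeral k) idᵈ) at (a , A) ≡ caseᵈ at (pair k a , A)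
  selector-at k a A = trans (∙pair-at caseᵈ (numeral k) idᵈ a A)
    (cong₂ (λ b c → caseᵈ at (pair b c , A)) (numeral-at k (a , A)) (id-at a A))

  fst-at : ∀ a A → fstᵈ at (a , A) ≡ fst a
  fst-at zero    A = trans (selector-at 0 0 A) (case-0 0 A)
  fst-at (suc a) A = trans (selector-at 0 (suc a) A)
    (trans (cong (λ b → caseᵈ at (pair 0 b , A)) (sym (pair-unpair a)))
      (case-zero (fst (suc a)) (snd (suc a)) A))

  snd-at : ∀ a A → sndᵈ at (a , A) ≡ snd a
  snd-at zero    A = trans (selector-at 1 0 A) (case-0 1 A)
  snd-at (suc a) A = trans (selector-at 1 (suc a) A)
    (trans (cong (λ b → caseᵈ at (pair 1 b , A)) (sym (pair-unpair a)))
      (case-suc 0 (fst (suc a)) (snd (suc a)) A))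

  termᵈ : Vec 𝔻 n → Term n → 𝔻
  termᵈ ρ (var i)   = lookup ρ i
  termᵈ ρ O         = numeral 0
  termᵈ ρ (S t)     = sucᵈ ∙ termᵈ ρ t
  termᵈ ρ (H t)     = fstᵈ ∙ termᵈ ρ t
  termᵈ ρ (T t)     = sndᵈ ∙ termᵈ ρ t
  termᵈ ρ (s ⊕ t)   = addᵈ ∙ pairᵈ (termᵈ ρ s) (termᵈ ρ t)
  termᵈ ρ (s ⊗ t)   = mulᵈ ∙ pairᵈ (termᵈ ρ s) (termᵈ ρ t)
  termᵈ ρ ⟨ s , t ⟩ = pairᵈ (termᵈ ρ s) (termᵈ ρ t)

  term-at : ∀ (ρ : Vec 𝔻 n) t ω → termᵈ ρ t at ω ≡ evalT (ρ at* ω) t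
  term-at ρ (var i)   ω = sym (lookup-map i _ ρ)
  term-at ρ O         ω = numeral-at 0 ω
  term-at ρ (S t)     ω@(a , A) = trans (∙-at _ (termᵈ ρ t) a A)
    (trans (suc-at _ A) (cong suc (term-at ρ t ω)))
  term-at ρ (H t)     ω@(a , A) = trans (∙-at fstᵈ (termᵈ ρ t) a A)
    (trans (fst-at _ A) (cong fst (term-at ρ t ω)))
  term-at ρ (T t)     ω@(a , A) = trans (∙-at sndᵈ (termᵈ ρ t) a A)
    (trans (snd-at _ A) (cong snd (term-at ρ t ω)))
  term-at ρ (s ⊕ t)   ω@(a , A) = trans (∙pair-at addᵈ (termᵈ ρ s) (termᵈ ρ t) a A)
    (trans (add-at (termᵈ ρ s at ω) (termᵈ ρ t at ω) A)
      (cong₂ ℕ._+_ (term-at ρ s ω) (term-at ρ t ω)))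
  term-at ρ (s ⊗ t)   ω@(a , A) = trans (∙pair-at mulᵈ (termᵈ ρ s) (termᵈ ρ t) a A)
    (trans (mul-at (termᵈ ρ s at ω) (termᵈ ρ t at ω) A)
      (cong₂ ℕ._*_ (term-at ρ s ω) (term-at ρ t ω)))
  term-at ρ ⟨ s , t ⟩ ω@(a , A) = trans (pair-at (termᵈ ρ s) (termᵈ ρ t) a A)
    (cong₂ pair (term-at ρ s ω) (term-at ρ t ω))

  Condition : Set₁
  Condition = Pred Point 0ℓ

  Definable : Condition → Set
  Definable D = Σ 𝔻 λ c → ∀ ω → Indicates (D ω) (c at ω)

  definable⇒dec : ∀ {D} → Definable D → ∀ ω → Dec (D ω)
  definable⇒dec (c , c-ind) ω = indicates⇒dec (c-ind ω)

  definable-resp : ∀ {D E} → D ⊆ E → E ⊆ D → Definable D → Definable E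
  definable-resp D⊆E E⊆D (c , c-ind) = c , λ ω → indicates-map D⊆E E⊆D (c-ind ω)

  definable-< : ∀ d e → Definable λ ω → d at ω < e at ω
  definable-< d e = ltᵈ ∙ pairᵈ d e , λ (a , A) →
    subst (Indicates _) (sym (∙pair-at ltᵈ d e a A)) (lt-at (d at (a , A)) (e at (a , A)) A)

  definable-⊥ : Definable λ _ → ⊥
  definable-⊥ = numeral 0 , λ ω → subst (Indicates _) (sym (numeral-at 0 ω)) (false id)

  implies : 𝔻 → 𝔻 → 𝔻
  implies c d = cond c (numeral 1) d

  implies-at : ∀ c d ω {Q Q′} → Indicates Q (c at ω) → Indicates Q′ (d at ω) →
               Indicates (Q → Q′) (implies c d at ω)
  implies-at c d ω {Q} {Q′} p q = go p refl
    where
    go : ∀ {k} → Indicates Q k → c at ω ≡ k → Indicates (Q → Q′) (implies c d at ω)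
    go (false ¬x) eq = subst (Indicates _)
      (sym (trans (cond-zero c (numeral 1) d eq) (numeral-at 1 ω))) (true (⊥-elim ∘ ¬x))
    go (true x)   eq = subst (Indicates _) (sym (cond-suc c (numeral 1) d eq))
      (indicates-map (λ y _ → y) (λ f → f x) q)

  definable-⇒ : ∀ {D E} → Definable D → Definable E → Definable λ ω → D ω → E ω
  definable-⇒ (c , c-ind) (d , d-ind) =
    implies c d , λ ω → implies-at c d ω (c-ind ω) (d-ind ω)

  definable-∁ : ∀ {D} → Definable D → Definable (∁ D)
  definable-∁ d = definable-⇒ d definable-⊥

  definable-∧ : ∀ {D E} → Definable D → Definable E → Definable (D ∩ E)
  definable-∧ d e = definable-resp
    (λ {ω} p → decidable-stable (definable⇒dec d ω) (λ ¬d → p λ q → ⊥-elim (¬d q))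
             , decidable-stable (definable⇒dec e ω) (λ ¬e → p λ _ → ¬e))
    (λ (p , q) r → r p q)
    (definable-∁ (definable-⇒ d (definable-∁ e)))

  definable-∨ : ∀ {D E} → Definable D → Definable E → Definable λ ω → D ω ⊎ E ω
  definable-∨ d e = definable-resp
    (λ {ω} p → split (definable⇒dec d ω) p)
    (λ { (inj₁ p) ¬d → ⊥-elim (¬d p) ; (inj₂ q) _ → q })
    (definable-⇒ (definable-∁ d) e)
    where
    split : ∀ {A B : Set} → Dec A → (¬ A → B) → A ⊎ B
    split (yes a) _ = inj₁ a
    split (no ¬a) k = inj₂ (k ¬a)

  definable-≡ : ∀ d e → Definable λ ω → d at ω ≡ e at ω
  definable-≡ d e = definable-resp
    (λ (p , q) → ℕₚ.≤-antisym (ℕₚ.≮⇒≥ q) (ℕₚ.≮⇒≥ p))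
    (λ p → ℕₚ.<-irrefl p , ℕₚ.<-irrefl (sym p))
    (definable-∧ (definable-∁ (definable-< d e)) (definable-∁ (definable-< e d)))

  definable-∈ : ∀ e p → Definable λ ω → model ω p (e at ω) ≡ true
  definable-∈ e X =
    definable-resp (λ {(a , A)} → to a A) (λ {(a , A)} → from a A)
      (definable-≡ (X⋆ ∙ e) (numeral 1))
    where
    oracle-at : ∀ a A → X⋆ at (a , A) ≡ χ 𝓐 A a
    oracle-at a A = at-unique X⋆ a A (graph⇐ (χ 𝓐 A) a)
    eq : ∀ a A → (X⋆ ∙ e) at (a , A) ≡ χ 𝓐 A (e at (a , A))
    eq a A = trans (∙-at X⋆ e a A) (oracle-at (e at (a , A)) A)
    to : ∀ a A → (X⋆ ∙ e) at (a , A) ≡ numeral 1 at (a , A) → A (e at (a , A)) ≡ true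
    to a A p = indicator-1 _ (trans (sym (eq a A)) (trans p (numeral-at 1 (a , A))))
    from : ∀ a A → A (e at (a , A)) ≡ true → (X⋆ ∙ e) at (a , A) ≡ numeral 1 at (a , A)
    from a A p = trans (eq a A)
      (trans (cong (if_then 1 else 0) p) (sym (numeral-at 1 (a , A))))
  definable-∈ e f⟨ d ⟩ =
    definable-resp (λ {(a , A)} (p , q) → to a A (e at (a , A)) refl p q)
                   (λ {(a , A)} → from a A (e at (a , A)) refl)
      (definable-∧ (definable-< (numeral 0) e)
                   (definable-≡ (d ∙ fstᵈ ∙ e) (sndᵈ ∙ e)))
    where
    eq₁ : ∀ a A → (d ∙ fstᵈ ∙ e) at (a , A) ≡ d at (fst (e at (a , A)) , A)
    eq₁ a A = trans (∙-at d _ a A)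
      (cong (λ b → d at (b , A)) (trans (∙-at fstᵈ e a A) (fst-at _ A)))
    eq₂ : ∀ a A → (sndᵈ ∙ e) at (a , A) ≡ snd (e at (a , A))
    eq₂ a A = trans (∙-at sndᵈ e a A) (snd-at _ A)
    to : ∀ a A k → e at (a , A) ≡ k → numeral 0 at (a , A) < e at (a , A) →
         (d ∙ fstᵈ ∙ e) at (a , A) ≡ (sndᵈ ∙ e) at (a , A) →
         standardModel 𝓐 A f⟨ d ⟩ (e at (a , A)) ≡ true
    to a A zero    eq p q = ⊥-elim (ℕₚ.n≮0 (subst (_ <_) eq p))
    to a A (suc k) eq p q = trans (cong (standardModel 𝓐 A f⟨ d ⟩)
      (trans eq (trans (sym (pair-unpair k)) (cong (pair (fst (suc k))) (sym val)))))
      (at-graph d (fst (suc k)) A)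
      where
      val : d at (fst (suc k) , A) ≡ snd (suc k)
      val = trans (cong (λ b → d at (fst b , A)) (sym eq))
        (trans (sym (eq₁ a A)) (trans q (trans (eq₂ a A) (cong snd eq))))
    from : ∀ a A k → e at (a , A) ≡ k → standardModel 𝓐 A f⟨ d ⟩ (e at (a , A)) ≡ true →
           numeral 0 at (a , A) < e at (a , A) ×
           (d ∙ fstᵈ ∙ e) at (a , A) ≡ (sndᵈ ∙ e) at (a , A)
    from a A zero    eq p = ⊥-elim (proj₂ (proj₂ (proj₂ (interp 𝓐 A d)))
      (trans (cong (standardModel 𝓐 A f⟨ d ⟩) (sym eq)) p))
    from a A (suc k) eq p =
      subst₂ _<_ (sym (numeral-at 0 (a , A))) (sym eq) (ℕ.s≤s ℕ.z≤n) ,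
      trans (eq₁ a A) (trans (trans (cong (λ b → d at (fst b , A)) eq)
        (trans (at-unique d (fst (suc k)) A (trans (cong (standardModel 𝓐 A f⟨ d ⟩)
          (trans (pair-unpair k) (sym eq))) p)) (cong snd (sym eq)))) (sym (eq₂ a A)))

  Definable₁ : (ℕ → Condition) → Set
  Definable₁ D = Σ 𝔻 λ c → ∀ b a A → Indicates (D b (a , A)) (c at (pair b a , A))

  definable₁⇒dec : ∀ {D} → Definable₁ D → ∀ b ω → Dec (D b ω)
  definable₁⇒dec (c , c-ind) b (a , A) = indicates⇒dec (c-ind b a A)

  definable₁-∁ : ∀ {D} → Definable₁ D → Definable₁ λ b → ∁ (D b)
  definable₁-∁ (c , c-ind) = implies c (numeral 0) , λ b a A →
    implies-at c (numeral 0) (pair b a , A) (c-ind b a A) (proj₂ definable-⊥ (pair b a , A))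

  least : ∀ {D} → Definable₁ D → (t : 𝔻) → Σ 𝔻 λ e → ∀ ω →
          (e at ω < t at ω → D (e at ω) ω) ×
          (∀ b → b < t at ω → D b ω → e at ω < t at ω)
  least {D} (c , c-ind) t = e , spec
    where
    e : 𝔻
    e = μᵈ c ∙ pairᵈ t idᵈ
    spec : ∀ ω → (e at ω < t at ω → D (e at ω) ω) ×
                 (∀ b → b < t at ω → D b ω → e at ω < t at ω)
    spec (a , A) =
      (λ lt → indicates-1 (c-ind (e at ω) a A)
        (at-unique c (pair (e at ω) a) A
          (proj₁ (proj₂ (proj₂ (axiom A (μᵈ c) (t at ω) (e at ω) 0 a))) (e-graph , lt)))) ,
      λ b b<t p → ℕₚ.≤-<-trans
        (≼⇒≤ (proj₁ (proj₂ (axiom A (μᵈ c) (t at ω) (e at ω) b a))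
          (e-graph , b<t , subst (λ k → standardModel 𝓐 A f⟨ c ⟩ (pair (pair b a) k) ≡ true)
                             (indicates-true (c-ind b a A) p) (at-graph c (pair b a) A))))
        b<t
      where
      ω : Point
      ω = a , A
      ≼⇒≤ : ∀ {k l} → k < l ⊎ k ≡ l → k ≤ l
      ≼⇒≤ (inj₁ p)    = ℕₚ.<⇒≤ p
      ≼⇒≤ (inj₂ refl) = ℕₚ.≤-refl
      e-at : e at ω ≡ μᵈ c at (pair (t at ω) a , A)
      e-at = trans (∙pair-at (μᵈ c) t idᵈ a A)
        (cong (λ k → μᵈ c at (pair (t at ω) k , A)) (id-at a A))
      e-graph : standardModel 𝓐 A f⟨ μᵈ c ⟩ (pair (pair (t at ω) a) (e at ω)) ≡ true
      e-graph = subst (λ k → standardModel 𝓐 A f⟨ μᵈ c ⟩ (pair (pair (t at ω) a) k) ≡ true)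
        (sym e-at) (at-graph (μᵈ c) (pair (t at ω) a) A)

  ⟦_⟧ : Formula (SetConstant 𝓐) n → Vec 𝔻 n → Condition
  ⟦ φ ⟧ ρ ω = model ω ⊨[ ρ at* ω ] φ

  shift : Vec 𝔻 n → Vec 𝔻 (suc n)
  shift ρ = fstᵈ ∷ map (_∙ sndᵈ) ρ

  shift-at : ∀ (ρ : Vec 𝔻 n) b a A → shift ρ at* (pair b a , A) ≡ b ∷ ρ at* (a , A)
  shift-at ρ b a A = cong₂ _∷_
    (trans (fst-at (pair b a) A) (fst-pair b a))
    (trans (sym (map-∘ (_at (pair b a , A)) (_∙ sndᵈ) ρ))
      (map-cong (λ d → trans (∙-at d sndᵈ (pair b a) A)
        (cong (λ c → d at (c , A)) (trans (snd-at (pair b a) A) (snd-pair b a)))) ρ))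

  definable-<ₜ : ∀ e (ρ : Vec 𝔻 n) t → Definable λ ω → e at ω < evalT (ρ at* ω) t
  definable-<ₜ e ρ t = definable-resp
    (λ {ω} → subst (e at ω <_) (term-at ρ t ω))
    (λ {ω} → subst (e at ω <_) (sym (term-at ρ t ω)))
    (definable-< e (termᵈ ρ t))

  <ₜ-wk : ∀ k (ρ : Vec 𝔻 n) t ω → k < evalT (ρ at* ω) t → k < evalT (k ∷ ρ at* ω) (wkT t)
  <ₜ-wk k ρ t ω = subst (k <_) (sym (evalT-wk k (ρ at* ω) t))

  <ₜ-wk⁻ : ∀ k (ρ : Vec 𝔻 n) t ω → k < evalT (k ∷ ρ at* ω) (wkT t) → k < evalT (ρ at* ω) t
  <ₜ-wk⁻ k ρ t ω = subst (k <_) (evalT-wk k (ρ at* ω) t)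

  least-below : ∀ {D} → Definable₁ D → (ρ : Vec 𝔻 n) → ∀ t → Σ 𝔻 λ e → ∀ ω →
                (e at ω < evalT (ρ at* ω) t → D (e at ω) ω) ×
                (∀ b → b < evalT (b ∷ ρ at* ω) (wkT t) → D b ω → e at ω < evalT (ρ at* ω) t)
  least-below {D = D} d ρ t = let e , spec = least d (termᵈ ρ t) in
    e , λ ω →
      (λ e<t → proj₁ (spec ω) (subst (e at ω <_) (sym (term-at ρ t ω)) e<t)) ,
      (λ b b<t p → subst (e at ω <_) (term-at ρ t ω)
        (proj₂ (spec ω) b (subst (b <_) (sym (term-at ρ t ω)) (<ₜ-wk⁻ b ρ t ω b<t)) p))

  module _ {φ : Formula (SetConstant 𝓐) (suc n)} (ρ : Vec 𝔻 n) (t : Term n)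
           (d : Definable₁ λ b ω → model ω ⊨[ b ∷ ρ at* ω ] φ) where

    example : Σ 𝔻 λ e → ∀ ω →
              (e at ω < evalT (ρ at* ω) t → model ω ⊨[ e at ω ∷ ρ at* ω ] φ) ×
              (⟦ ∃< t φ ⟧ ρ ω → e at ω < evalT (ρ at* ω) t)
    example = let e , spec = least-below d ρ t in
      e , λ ω → proj₁ (spec ω) , λ (b , b<t , p) → proj₂ (spec ω) b b<t p

    counterexample : Σ 𝔻 λ e → ∀ ω →
                     (e at ω < evalT (ρ at* ω) t → ¬ (model ω ⊨[ e at ω ∷ ρ at* ω ] φ)) ×
                     (¬ ⟦ ∀< t φ ⟧ ρ ω → e at ω < evalT (ρ at* ω) t)
    counterexample = let e , spec = least-below (definable₁-∁ d) ρ t in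
      e , λ ω → proj₁ (spec ω) , λ ¬all →
        decidable-stable (definable⇒dec (definable-<ₜ e ρ t) ω) λ e≮t →
          ¬all λ b b<t → decidable-stable (definable₁⇒dec d b ω) λ ¬p →
            e≮t (proj₂ (spec ω) b b<t ¬p)

  bounded-definable  : {φ : Formula (SetConstant 𝓐) n} → Bounded φ →
                       ∀ ρ → Definable (⟦ φ ⟧ ρ)
  bounded-definable₁ : {φ : Formula (SetConstant 𝓐) (suc n)} → Bounded φ →
                       ∀ ρ → Definable₁ λ b ω → model ω ⊨[ b ∷ ρ at* ω ] φ

  bounded-definable ⊥′       ρ = definable-⊥
  bounded-definable (s ≐ t)  ρ = definable-resp
    (λ {ω} → subst₂ _≡_ (term-at ρ s ω) (term-at ρ t ω))
    (λ {ω} → subst₂ _≡_ (sym (term-at ρ s ω)) (sym (term-at ρ t ω)))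
    (definable-≡ (termᵈ ρ s) (termᵈ ρ t))
  bounded-definable (s ≺ t)  ρ = definable-resp
    (λ {ω} → subst (_< evalT (ρ at* ω) t) (term-at ρ s ω))
    (λ {ω} → subst (_< evalT (ρ at* ω) t) (sym (term-at ρ s ω)))
    (definable-<ₜ (termᵈ ρ s) ρ t)
  bounded-definable (t ∈ₛ p) ρ = definable-resp
    (λ {ω} → subst (λ k → model ω p k ≡ true) (term-at ρ t ω))
    (λ {ω} → subst (λ k → model ω p k ≡ true) (sym (term-at ρ t ω)))
    (definable-∈ (termᵈ ρ t) p)
  bounded-definable (b ⇒ c)  ρ = definable-⇒ (bounded-definable b ρ) (bounded-definable c ρ)
  bounded-definable (b ∧ c)  ρ = definable-∧ (bounded-definable b ρ) (bounded-definable c ρ)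
  bounded-definable (b ∨ c)  ρ = definable-∨ (bounded-definable b ρ) (bounded-definable c ρ)
  bounded-definable (∀<ᵇ t b) ρ =
    let e , spec = counterexample ρ t (bounded-definable₁ b ρ) in definable-resp
      (λ {ω} e≮t a a<t → decidable-stable (definable₁⇒dec (bounded-definable₁ b ρ) a ω)
        λ ¬p → e≮t (proj₂ (spec ω) λ all → ¬p (all a a<t)))
      (λ {ω} all e<t → proj₁ (spec ω) e<t (all (e at ω) (<ₜ-wk (e at ω) ρ t ω e<t)))
      (definable-∁ (definable-<ₜ e ρ t))
  bounded-definable (∃<ᵇ t b) ρ =
    let e , spec = example ρ t (bounded-definable₁ b ρ) in definable-resp
      (λ {ω} e<t → e at ω , <ₜ-wk (e at ω) ρ t ω e<t , proj₁ (spec ω) e<t)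
      (λ {ω} → proj₂ (spec ω))
      (definable-<ₜ e ρ t)

  bounded-definable₁ {φ = φ} b ρ = let c , c-ind = bounded-definable b (shift ρ) in
    c , λ k a A → subst (λ v → Indicates (standardModel 𝓐 A ⊨[ v ] φ) (c at (pair k a , A)))
                    (shift-at ρ k a A) (c-ind (pair k a , A))

  record Answer : Set₂ where
    field
      R     : Condition → Set₁
      mono  : ∀ {V W} → V ⊆ W → R W → R V
      void  : ∀ {W} → (∀ ω → ¬ W ω) → R W
      merge : ∀ {W D} → Definable D → R (W ∩ D) → R (W ∩ ∁ D) → R W

module Forcing (𝓐 : ClassOfFunctionAlgebras) (answer : Functions.Answer 𝓐) where

  open Functions 𝓐
  open Answer answer

  infix 1 _⊩[_]_

  -- Negative translation with ⊥ replaced by R: an atom is forced when R holds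
  -- wherever the atom fails, and ∨ and ∃ are read through their eliminations.
  _⊩[_]_ : Condition → Vec 𝔻 n → Formula (SetConstant 𝓐) n → Set₁
  W ⊩[ ρ ] ⊥′     = R W
  W ⊩[ ρ ] s ≐ t  = R (W ∩ ∁ (⟦ s ≐ t ⟧ ρ))
  W ⊩[ ρ ] s ≺ t  = R (W ∩ ∁ (⟦ s ≺ t ⟧ ρ))
  W ⊩[ ρ ] t ∈ₛ p = R (W ∩ ∁ (⟦ t ∈ₛ p ⟧ ρ))
  W ⊩[ ρ ] φ ⇒ ψ  = ∀ V → V ⊆ W → V ⊩[ ρ ] φ → V ⊩[ ρ ] ψ
  W ⊩[ ρ ] φ ∧ ψ  = (W ⊩[ ρ ] φ) × (W ⊩[ ρ ] ψ)
  W ⊩[ ρ ] φ ∨ ψ  = ∀ V → V ⊆ W → (∀ U → U ⊆ V → U ⊩[ ρ ] φ → R U) →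
                                    (∀ U → U ⊆ V → U ⊩[ ρ ] ψ → R U) → R V
  W ⊩[ ρ ] ∀′ φ   = ∀ e → W ⊩[ e ∷ ρ ] φ
  W ⊩[ ρ ] ∃′ φ   = ∀ V → V ⊆ W → (∀ e U → U ⊆ V → U ⊩[ e ∷ ρ ] φ → R U) → R V

  private variable
    U V W : Condition
    ρ ρ′  : Vec 𝔻 n

  ⊩-mono : (φ : Formula (SetConstant 𝓐) n) → V ⊆ W → W ⊩[ ρ ] φ → V ⊩[ ρ ] φ
  ⊩-mono ⊥′       V⊆W p       = mono V⊆W p
  ⊩-mono (s ≐ t)  V⊆W p       = mono (λ (v , q) → V⊆W v , q) p
  ⊩-mono (s ≺ t)  V⊆W p       = mono (λ (v , q) → V⊆W v , q) p
  ⊩-mono (t ∈ₛ q) V⊆W p       = mono (λ (v , q) → V⊆W v , q) p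
  ⊩-mono (φ ⇒ ψ)  V⊆W p       = λ U U⊆V → p U (V⊆W ∘ U⊆V)
  ⊩-mono (φ ∧ ψ)  V⊆W (p , q) = ⊩-mono φ V⊆W p , ⊩-mono ψ V⊆W q
  ⊩-mono (φ ∨ ψ)  V⊆W p       = λ U U⊆V → p U (V⊆W ∘ U⊆V)
  ⊩-mono (∀′ φ)   V⊆W p       = λ e → ⊩-mono φ V⊆W (p e)
  ⊩-mono (∃′ φ)   V⊆W p       = λ U U⊆V → p U (V⊆W ∘ U⊆V)

  ⊩-stable : (φ : Formula (SetConstant 𝓐) n) →
             (∀ V → V ⊆ W → (∀ U → U ⊆ V → U ⊩[ ρ ] φ → R U) → R V) → W ⊩[ ρ ] φ
  ⊩-stable ⊥′       k = k _ id λ _ _ r → r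
  ⊩-stable (s ≐ t)  k = k _ proj₁ λ _ U⊆ → mono λ u → u , proj₂ (U⊆ u)
  ⊩-stable (s ≺ t)  k = k _ proj₁ λ _ U⊆ → mono λ u → u , proj₂ (U⊆ u)
  ⊩-stable (t ∈ₛ q) k = k _ proj₁ λ _ U⊆ → mono λ u → u , proj₂ (U⊆ u)
  ⊩-stable (φ ⇒ ψ)  k = λ V V⊆W p → ⊩-stable ψ λ V′ V′⊆V j →
    k V′ (V⊆W ∘ V′⊆V) λ U U⊆V′ pq → j U U⊆V′ (pq U id (⊩-mono φ (V′⊆V ∘ U⊆V′) p))
  ⊩-stable (φ ∧ ψ)  k =
    (⊩-stable φ λ V V⊆W j → k V V⊆W λ U U⊆V p → j U U⊆V (proj₁ p)) ,
    (⊩-stable ψ λ V V⊆W j → k V V⊆W λ U U⊆V p → j U U⊆V (proj₂ p))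
  ⊩-stable (φ ∨ ψ)  k = λ V V⊆W i j → k V V⊆W λ U U⊆V p →
    p U id (λ U′ U′⊆U → i U′ (U⊆V ∘ U′⊆U)) (λ U′ U′⊆U → j U′ (U⊆V ∘ U′⊆U))
  ⊩-stable (∀′ φ)   k = λ e → ⊩-stable φ λ V V⊆W j → k V V⊆W λ U U⊆V p → j U U⊆V (p e)
  ⊩-stable (∃′ φ)   k = λ V V⊆W j → k V V⊆W λ U U⊆V p →
    p U id λ e U′ U′⊆U → j e U′ (U⊆V ∘ U′⊆U)

  ⊩-exfalso : (φ : Formula (SetConstant 𝓐) n) → R W → W ⊩[ ρ ] φ
  ⊩-exfalso φ r = ⊩-stable φ λ V V⊆W _ → mono V⊆W r

  ⊩-local : (φ : Formula (SetConstant 𝓐) n) → ∀ {D} → Definable D →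
            (W ∩ D) ⊩[ ρ ] φ → (W ∩ ∁ D) ⊩[ ρ ] φ → W ⊩[ ρ ] φ
  ⊩-local φ d p q = ⊩-stable φ λ V V⊆W k → merge d
    (k _ proj₁ (⊩-mono φ (λ (v , x) → V⊆W v , x) p))
    (k _ proj₁ (⊩-mono φ (λ (v , x) → V⊆W v , x) q))

  Agree : Condition → Vec 𝔻 n → (Fin m → Term n) → Vec 𝔻 m → Set
  Agree W ρ σ ρ′ = ∀ {ω} → W ω → ∀ i → evalT (ρ at* ω) (σ i) ≡ lookup (ρ′ at* ω) i

  agree-lift : ∀ {σ : Fin m → Term n} {e} → Agree W ρ σ ρ′ → Agree W (e ∷ ρ) (lift σ) (e ∷ ρ′)
  agree-lift         ag w zero    = refl
  agree-lift {σ = σ} ag w (suc i) = trans (evalT-wk _ _ (σ i)) (ag w i)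

  agree-wk : ∀ {e} {ρ : Vec 𝔻 n} → Agree W (e ∷ ρ) (var ∘ suc) ρ
  agree-wk w i = refl

  agree-inst : ∀ t {ρ : Vec 𝔻 n} → Agree W ρ (inst t) (termᵈ ρ t ∷ ρ)
  agree-inst t {ρ} {ω} w zero    = sym (term-at ρ t ω)
  agree-inst t         w (suc i) = refl

  ⊩-sub : (φ : Formula (SetConstant 𝓐) m) {σ : Fin m → Term n} → Agree W ρ σ ρ′ →
          ((W ⊩[ ρ ] sub σ φ) → (W ⊩[ ρ′ ] φ)) × ((W ⊩[ ρ′ ] φ) → (W ⊩[ ρ ] sub σ φ))
  ⊩-sub ⊥′       ag = id , id
  ⊩-sub (s ≐ t)  ag =
    mono (λ (w , ¬p) → w , λ p → ¬p (subst₂ _≡_ (evalT-sub (ag w) s) (evalT-sub (ag w) t) p)) ,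
    mono (λ (w , ¬p) → w , λ p →
      ¬p (subst₂ _≡_ (sym (evalT-sub (ag w) s)) (sym (evalT-sub (ag w) t)) p))
  ⊩-sub (s ≺ t)  ag =
    mono (λ (w , ¬p) → w , λ p → ¬p (subst₂ _<_ (evalT-sub (ag w) s) (evalT-sub (ag w) t) p)) ,
    mono (λ (w , ¬p) → w , λ p →
      ¬p (subst₂ _<_ (sym (evalT-sub (ag w) s)) (sym (evalT-sub (ag w) t)) p))
  ⊩-sub (t ∈ₛ q) ag =
    mono (λ {ω} (w , ¬p) → w , λ p → ¬p (subst (λ k → model ω q k ≡ true) (evalT-sub (ag w) t) p)) ,
    mono (λ {ω} (w , ¬p) → w , λ p →
      ¬p (subst (λ k → model ω q k ≡ true) (sym (evalT-sub (ag w) t)) p))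
  ⊩-sub (φ ⇒ ψ)  ag =
    (λ p V V⊆W q → proj₁ (⊩-sub ψ (ag ∘ V⊆W)) (p V V⊆W (proj₂ (⊩-sub φ (ag ∘ V⊆W)) q))) ,
    (λ p V V⊆W q → proj₂ (⊩-sub ψ (ag ∘ V⊆W)) (p V V⊆W (proj₁ (⊩-sub φ (ag ∘ V⊆W)) q)))
  ⊩-sub (φ ∧ ψ)  ag =
    (λ (p , q) → proj₁ (⊩-sub φ ag) p , proj₁ (⊩-sub ψ ag) q) ,
    (λ (p , q) → proj₂ (⊩-sub φ ag) p , proj₂ (⊩-sub ψ ag) q)
  ⊩-sub (φ ∨ ψ)  ag =
    (λ p V V⊆W i j → p V V⊆W
      (λ U U⊆V → i U U⊆V ∘ proj₁ (⊩-sub φ (ag ∘ V⊆W ∘ U⊆V)))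
      (λ U U⊆V → j U U⊆V ∘ proj₁ (⊩-sub ψ (ag ∘ V⊆W ∘ U⊆V)))) ,
    (λ p V V⊆W i j → p V V⊆W
      (λ U U⊆V → i U U⊆V ∘ proj₂ (⊩-sub φ (ag ∘ V⊆W ∘ U⊆V)))
      (λ U U⊆V → j U U⊆V ∘ proj₂ (⊩-sub ψ (ag ∘ V⊆W ∘ U⊆V))))
  ⊩-sub (∀′ φ) {σ} ag =
    (λ p e → proj₁ (⊩-sub φ (agree-lift {σ = σ} ag)) (p e)) ,
    (λ p e → proj₂ (⊩-sub φ (agree-lift {σ = σ} ag)) (p e))
  ⊩-sub (∃′ φ) {σ} ag =
    (λ p V V⊆W k → p V V⊆W λ e U U⊆V →
      k e U U⊆V ∘ proj₁ (⊩-sub φ (agree-lift {σ = σ} (ag ∘ V⊆W ∘ U⊆V)))) ,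
    (λ p V V⊆W k → p V V⊆W λ e U U⊆V →
      k e U U⊆V ∘ proj₂ (⊩-sub φ (agree-lift {σ = σ} (ag ∘ V⊆W ∘ U⊆V))))

  ⊩-mono* : {Γ : List (Formula (SetConstant 𝓐) n)} → V ⊆ W →
            All (W ⊩[ ρ ]_) Γ → All (V ⊩[ ρ ]_) Γ
  ⊩-mono* V⊆W = All.map λ {φ} → ⊩-mono φ V⊆W

  ⊩-wk* : {Γ : List (Formula (SetConstant 𝓐) n)} → ∀ {e} →
          All (W ⊩[ ρ ]_) Γ → All (W ⊩[ e ∷ ρ ]_) (List.map wk Γ)
  ⊩-wk* {W = W} {ρ = ρ} {e = e} γ =
    map⁺ (All.map (λ {φ} → proj₂ (⊩-sub φ (agree-wk {W = W} {e = e} {ρ = ρ}))) γ)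

  soundness : {Th : Formula (SetConstant 𝓐) 0 → Set} →
              (∀ {φ} → Th φ → ∀ W → W ⊩[ [] ] φ) →
              {Γ : List (Formula (SetConstant 𝓐) n)} {φ : Formula (SetConstant 𝓐) n} →
              Th ∣ Γ ⊢ φ → ∀ W ρ → All (W ⊩[ ρ ]_) Γ → W ⊩[ ρ ] φ
  soundness th (ax {φ} a) W ρ γ = proj₂ (⊩-sub φ λ _ ()) (th a W)
  soundness th (hyp i) W ρ γ = All.lookup γ i
  soundness th (raa {φ} p) W ρ γ = ⊩-stable φ λ V V⊆W k →
    soundness th p V ρ (k ∷ ⊩-mono* V⊆W γ)
  soundness th (⇒I p) W ρ γ V V⊆W q = soundness th p V ρ (q ∷ ⊩-mono* V⊆W γ)
  soundness th (⇒E p q) W ρ γ = soundness th p W ρ γ W id (soundness th q W ρ γ)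
  soundness th (∧I p q) W ρ γ = soundness th p W ρ γ , soundness th q W ρ γ
  soundness th (∧E₁ p) W ρ γ = proj₁ (soundness th p W ρ γ)
  soundness th (∧E₂ p) W ρ γ = proj₂ (soundness th p W ρ γ)
  soundness th (∨I₁ {φ} p) W ρ γ V V⊆W i j = i V id (⊩-mono φ V⊆W (soundness th p W ρ γ))
  soundness th (∨I₂ {φ} {ψ} p) W ρ γ V V⊆W i j = j V id (⊩-mono ψ V⊆W (soundness th p W ρ γ))
  soundness th (∨E {χ = χ} p q r) W ρ γ = ⊩-stable χ λ V V⊆W k →
    soundness th p W ρ γ V V⊆W
      (λ U U⊆V x → k U U⊆V (soundness th q U ρ (x ∷ ⊩-mono* (V⊆W ∘ U⊆V) γ)))
      (λ U U⊆V x → k U U⊆V (soundness th r U ρ (x ∷ ⊩-mono* (V⊆W ∘ U⊆V) γ)))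
  soundness th (∀I p) W ρ γ e = soundness th p W (e ∷ ρ) (⊩-wk* γ)
  soundness th (∀E {φ} p t) W ρ γ =
    proj₂ (⊩-sub φ (agree-inst {W = W} t)) (soundness th p W ρ γ (termᵈ ρ t))
  soundness th (∃I {φ} t p) W ρ γ V V⊆W k = k (termᵈ ρ t) V id
    (⊩-mono φ V⊆W (proj₁ (⊩-sub φ (agree-inst {W = W} t)) (soundness th p W ρ γ)))
  soundness th (∃E {ψ = ψ} p q) W ρ γ = ⊩-stable ψ λ V V⊆W k →
    soundness th p W ρ γ V V⊆W λ e U U⊆V x → k U U⊆V
      (proj₁ (⊩-sub ψ (agree-wk {W = U} {e = e} {ρ = ρ}))
        (soundness th q U (e ∷ ρ) (x ∷ ⊩-wk* (⊩-mono* (V⊆W ∘ U⊆V) γ))))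
  soundness th (≐I {t}) W ρ γ = void λ _ (_ , ¬p) → ¬p refl
  soundness th (≐E {s} {t} φ p q) W ρ γ = ⊩-local φ[t] s≐t
    (proj₂ (⊩-sub φ (agree-inst {W = W ∩ ⟦ s ≐ t ⟧ ρ} t))
      (proj₁ (⊩-sub {ρ′ = termᵈ ρ t ∷ ρ} φ agree) (⊩-mono (φ [ s ]) proj₁ (soundness th q W ρ γ))))
    (⊩-exfalso φ[t] (soundness th p W ρ γ))
    where
    φ[t] = φ [ t ]
    s≐t : Definable (⟦ s ≐ t ⟧ ρ)
    s≐t = bounded-definable (s ≐ t) ρ
    agree : Agree (W ∩ ⟦ s ≐ t ⟧ ρ) ρ (inst s) (termᵈ ρ t ∷ ρ)
    agree {ω} (w , eq) zero    = trans eq (sym (term-at ρ t ω))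
    agree     (w , eq) (suc i) = refl

  cover : ∀ {D} → Definable D → R U → R V → W ∩ D ⊆ U → W ∩ ∁ D ⊆ V → R W
  cover d u v D⊆U ∁D⊆V = merge d (mono D⊆U u) (mono ∁D⊆V v)

  ⊩⇒R : {φ : Formula (SetConstant 𝓐) n} → Bounded φ → ∀ {W ρ} →
        W ⊩[ ρ ] φ → R (W ∩ ∁ (⟦ φ ⟧ ρ))
  R⇒⊩ : {φ : Formula (SetConstant 𝓐) n} → Bounded φ → ∀ {W ρ} →
        R (W ∩ ∁ (⟦ φ ⟧ ρ)) → W ⊩[ ρ ] φ

  ⊩⇒R ⊥′       p = mono proj₁ p
  ⊩⇒R (s ≐ t)  p = p
  ⊩⇒R (s ≺ t)  p = p
  ⊩⇒R (t ∈ₛ q) p = p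
  ⊩⇒R (b ⇒ c) p = mono (λ (w , ¬pq) → (w , ¬pq) , λ q → ¬pq λ _ → q)
    (⊩⇒R c (p _ proj₁ (R⇒⊩ b (void λ ω ((_ , ¬pq) , ¬p) → ¬pq (⊥-elim ∘ ¬p)))))
  ⊩⇒R (b ∧ c) {ρ = ρ} (p , q) = cover (bounded-definable b ρ) (⊩⇒R c q) (⊩⇒R b p)
    (λ ((w , ¬pq) , x) → w , λ y → ¬pq (x , y))
    (λ ((w , ¬pq) , ¬x) → w , ¬x)
  ⊩⇒R (b ∨ c) p = p _ proj₁
    (λ U U⊆ q → mono (λ u → u , proj₂ (U⊆ u) ∘ inj₁) (⊩⇒R b q))
    (λ U U⊆ q → mono (λ u → u , proj₂ (U⊆ u) ∘ inj₂) (⊩⇒R c q))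
  ⊩⇒R (∀<ᵇ t b) {ρ = ρ} p =
    let e , spec = counterexample ρ t (bounded-definable₁ b ρ) in
    mono (λ {ω} (w , ¬all) → (w , ¬all) , proj₁ (spec ω) (proj₂ (spec ω) ¬all))
      (⊩⇒R b (p e _ proj₁ (void λ ω ((_ , ¬all) , e≮t) →
        e≮t (<ₜ-wk (e at ω) ρ t ω (proj₂ (spec ω) ¬all)))))
  ⊩⇒R (∃<ᵇ t b) {ρ = ρ} p = p _ proj₁ λ e U U⊆ (lt , q) →
    cover (bounded-definable (var 0F ≺ wkT t) (e ∷ ρ)) (⊩⇒R b q) lt
      (λ {ω} (u , e<t) → u , λ x → proj₂ (U⊆ u) (e at ω , e<t , x))
      id

  R⇒⊩ ⊥′       r = mono (λ w → w , id) r
  R⇒⊩ (s ≐ t)  r = r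
  R⇒⊩ (s ≺ t)  r = r
  R⇒⊩ (t ∈ₛ q) r = r
  R⇒⊩ (b ⇒ c) {ρ = ρ} r V V⊆W p = R⇒⊩ c (cover (bounded-definable b ρ) r (⊩⇒R b p)
    (λ ((v , ¬q) , p) → V⊆W v , λ pq → ¬q (pq p))
    (λ ((v , ¬q) , ¬p) → v , ¬p))
  R⇒⊩ (b ∧ c) r =
    R⇒⊩ b (mono (λ (w , ¬p) → w , ¬p ∘ proj₁) r) ,
    R⇒⊩ c (mono (λ (w , ¬p) → w , ¬p ∘ proj₂) r)
  R⇒⊩ (b ∨ c) {ρ = ρ} r V V⊆W i j =
    merge (bounded-definable b ρ)
      (i _ proj₁ (R⇒⊩ b (void λ _ ((_ , p) , ¬p) → ¬p p)))
      (merge (bounded-definable c ρ)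
        (j _ (proj₁ ∘ proj₁) (R⇒⊩ c (void λ _ ((_ , q) , ¬q) → ¬q q)))
        (mono (λ ((v , ¬p) , ¬q) → V⊆W v , λ { (inj₁ p) → ¬p p ; (inj₂ q) → ¬q q }) r))
  R⇒⊩ (∀<ᵇ t b) {ρ = ρ} r e V V⊆W lt = R⇒⊩ b
    (cover (bounded-definable (var 0F ≺ wkT t) (e ∷ ρ)) r lt
      (λ {ω} ((v , ¬p) , e<t) → V⊆W v , λ all → ¬p (all (e at ω) e<t))
      (λ ((v , ¬p) , e≮t) → v , e≮t))
  R⇒⊩ (∃<ᵇ t b) {ρ = ρ} r V V⊆W k =
    let e , spec = example ρ t (bounded-definable₁ b ρ) in
    merge (bounded-definable (∃<ᵇ t b) ρ)
      (k e _ proj₁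
        ( void (λ ω ((_ , x) , e≮t) → e≮t (<ₜ-wk (e at ω) ρ t ω (proj₂ (spec ω) x)))
        , R⇒⊩ b (void λ ω ((_ , x) , ¬p) → ¬p (proj₁ (spec ω) (proj₂ (spec ω) x)))))
      (mono (λ (v , ¬p) → V⊆W v , ¬p) r)

  closure-⊩ : (φ : Formula (SetConstant 𝓐) n) → (∀ ρ → W ⊩[ ρ ] φ) → W ⊩[ [] ] closure φ
  closure-⊩ {n = zero}  φ p = p []
  closure-⊩ {n = suc n} φ p = closure-⊩ (∀′ φ) λ ρ e → p (e ∷ ρ)

  ⊩-universal : (φ : Formula (SetConstant 𝓐) n) → Bounded φ →
                (∀ ω → model ω ⊨ closure φ) → ∀ W → W ⊩[ [] ] closure φ
  ⊩-universal φ b p W = closure-⊩ φ λ ρ →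
    R⇒⊩ b (void λ ω (_ , ¬q) → ¬q (closure-⊨ φ (p ω) (ρ at* ω)))

  ⊩-axiom : ∀ {φ} → RA₁ 𝓐 φ → ∀ W → W ⊩[ [] ] φ
  ⊩-axiom (basic b) W with BASIC-universal b
  ... | n , ψ , bψ , refl = ⊩-universal ψ bψ (λ (_ , A) → standardModel-models 𝓐 A (basic b)) W
  ⊩-axiom oracle = ⊩-universal {n = 1}
    ((var 0F ∈ₛ X ⇒ f⟨ X⋆ ⟩ ⦅ var 0F ⦆≐ one) ∧ (∼ var 0F ∈ₛ X ⇒ f⟨ X⋆ ⟩ ⦅ var 0F ⦆≐ O))
    (qf⇒bounded _) λ (_ , A) → standardModel-models 𝓐 A oracle
  ⊩-axiom (operator {o} o∈ ds) W
    rewrite mapP-closure (assign o f⟨ op o∈ ds ⟩ (λ i → f⟨ lookup ds i ⟩)) (matrix o) =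
    ⊩-universal _
      (mapP-bounded _ (qf⇒bounded (quantifierFree (All.lookup (areOperators 𝓐) o∈))))
      (λ (_ , A) → subst (standardModel 𝓐 A ⊨_) (mapP-closure _ (matrix o))
                     (standardModel-models 𝓐 A (operator o∈ ds)))
      W
  ⊩-axiom (function d) W =
    (λ e V _ k → k (d ∙ e) V id (void λ { (a , A) (_ , ¬p) → ¬p
      (subst (λ b → standardModel 𝓐 A f⟨ d ⟩ (pair (e at (a , A)) b) ≡ true)
        (sym (∙-at d e a A)) (at-graph d (e at (a , A)) A)) })) ,
    ⊩-universal {n = 3}
      (⟨ var 2F , var 1F ⟩ ∈ₛ f⟨ d ⟩ ∧ ⟨ var 2F , var 0F ⟩ ∈ₛ f⟨ d ⟩ ⇒ var 1F ≐ var 0F)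
      (qf⇒bounded _) (λ (_ , A) → proj₁ (proj₂ (total A))) W ,
    ⊩-universal {n = 0} (∼ O ∈ₛ f⟨ d ⟩) (qf⇒bounded _) (λ (_ , A) → proj₂ (proj₂ (total A))) W
    where
    total : ∀ A → standardModel 𝓐 A ⊨ isFunction f⟨ d ⟩
    total A = standardModel-models 𝓐 A (function d)

  Σ⁰₁-⊩⇒R : {φ : Formula (SetConstant 𝓐) n} → Σ⁰₁ φ → W ⊩[ ρ ] φ →
            (∀ V → V ⊆ W → V ⊆ ⟦ φ ⟧ ρ → R V) → R W
  Σ⁰₁-⊩⇒R {ρ = ρ} (bounded b) p k =
    merge (bounded-definable b ρ) (k _ proj₁ proj₂) (⊩⇒R b p)
  Σ⁰₁-⊩⇒R (∃′ s) p k = p _ id λ e U U⊆W q →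
    Σ⁰₁-⊩⇒R s q λ V V⊆U x → k V (U⊆W ∘ V⊆U) λ {ω} v → e at ω , x v

  -- Over a single point every witness is a numeral.
  Σ⁰₁-⊨⇒⊩ : {φ : Formula (SetConstant 𝓐) n} → Σ⁰₁ φ → ∀ ω ρ → W ⊆ (ω ≡_) →
            ⟦ φ ⟧ ρ ω → W ⊩[ ρ ] φ
  Σ⁰₁-⊨⇒⊩ (bounded b) ω ρ W⊆ω p = R⇒⊩ b (void λ ω′ (w , ¬p) → ¬p (subst (⟦ _ ⟧ ρ) (W⊆ω w) p))
  Σ⁰₁-⊨⇒⊩ (∃′ {φ} s) ω ρ W⊆ω (k , p) V V⊆W j = j (numeral k) V id
    (Σ⁰₁-⊨⇒⊩ s ω (numeral k ∷ ρ) (W⊆ω ∘ V⊆W)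
      (subst (λ c → model ω ⊨[ c ∷ ρ at* ω ] φ) (sym (numeral-at k ω)) p))

module Extraction (𝓐 : ClassOfFunctionAlgebras) {φ : Formula (SetConstant 𝓐) 2}
                  (φ-Σ : Σ⁰₁ φ) (φ-total : RA₁ 𝓐 ⊢ ∀′ (∃!′ φ)) where

  open Functions 𝓐

  Holds : Point → ℕ → Set
  Holds ω@(a , _) b = model ω ⊨[ b ∷ a ∷ [] ] φ

  holds-⟦⟧ : ∀ e ω → Holds ω (e at ω) → ⟦ φ ⟧ (e ∷ idᵈ ∷ []) ω
  holds-⟦⟧ e ω@(a , A) = subst (λ b → model ω ⊨[ e at ω ∷ b ∷ [] ] φ) (sym (id-at a A))

  ⟦⟧-holds : ∀ e ω → ⟦ φ ⟧ (e ∷ idᵈ ∷ []) ω → Holds ω (e at ω)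
  ⟦⟧-holds e ω@(a , A) = subst (λ b → model ω ⊨[ e at ω ∷ b ∷ [] ] φ) (id-at a A)

  record Realized (W : Condition) : Set₁ where
    constructor realized
    field
      realizer : 𝔻
      holds    : ∀ ω → W ω → Holds ω (realizer at ω)

  open Realized

  realization : Answer
  realization = record
    { R     = Realized
    ; mono  = λ V⊆W (realized e p) → realized e λ ω → p ω ∘ V⊆W
    ; void  = λ ¬W → realized idᵈ λ ω w → ⊥-elim (¬W ω w)
    ; merge = λ { (c , c-ind) (realized d p) (realized e q) → realized (cond c e d) λ ω w →
        go c d e ω (c-ind ω) refl (λ x → p ω (w , x)) (λ ¬x → q ω (w , ¬x)) }
    }
    where
    go : ∀ c d e ω {k Q} → Indicates Q k → c at ω ≡ k →
         (Q → Holds ω (d at ω)) → (¬ Q → Holds ω (e at ω)) → Holds ω (cond c e d at ω)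
    go c d e ω (true x)   eq p q = subst (Holds ω) (sym (cond-suc c e d eq)) (p x)
    go c d e ω (false ¬x) eq p q = subst (Holds ω) (sym (cond-zero c e d eq)) (q ¬x)

  realizable : Realized (λ _ → ⊤)
  realizable = soundness ⊩-axiom φ-total _ [] [] idᵈ _ id λ e U _ (p , _) →
    Σ⁰₁-⊩⇒R φ-Σ p λ V _ x → realized e λ ω v → ⟦⟧-holds e ω (x v)
    where open Forcing 𝓐 realization

  unique : ∀ ω {b c} → Holds ω b → Holds ω c → b ≡ c
  unique ω {b} {c} p q = lower conclusion refl
    where
    equality : Answer
    equality = record
      { R     = λ W → Lift _ (W ω → b ≡ c)
      ; mono  = λ V⊆W (Level.lift r) → Level.lift (r ∘ V⊆W)
      ; void  = λ ¬W → Level.lift (⊥-elim ∘ ¬W ω)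
      ; merge = λ d (Level.lift r) (Level.lift s) → Level.lift λ w → case definable⇒dec d ω of λ
          { (yes x) → r (w , x) ; (no ¬x) → s (w , ¬x) }
      }
    open Forcing 𝓐 equality

    numeral-⊩ : ∀ k {U} → U ⊆ (ω ≡_) → Holds ω k → U ⊩[ numeral k ∷ idᵈ ∷ [] ] φ
    numeral-⊩ k U⊆ω r = Σ⁰₁-⊨⇒⊩ φ-Σ ω (numeral k ∷ idᵈ ∷ []) U⊆ω
      (holds-⟦⟧ (numeral k) ω (subst (Holds ω) (sym (numeral-at k ω)) r))

    conclusion : Lift _ (ω ≡ ω → b ≡ c)
    conclusion = soundness ⊩-axiom φ-total (ω ≡_) [] [] idᵈ _ id λ e U U⊆ω (_ , uniq) →
      let eq = λ k (r : Holds ω k) → uniq (numeral k) U id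
                 (proj₂ (⊩-sub φ λ { _ 0F → refl ; _ 1F → refl }) (numeral-⊩ k U⊆ω r))
      in Level.lift λ u → case numeral b at ω ℕ.≟ e at ω of λ
        { (no b≢e)  → lower (eq b p) (u , b≢e)
        ; (yes b≡e) → case numeral c at ω ℕ.≟ e at ω of λ
          { (no c≢e)  → lower (eq c q) (u , c≢e)
          ; (yes c≡e) → trans (sym (numeral-at b ω))
                          (trans b≡e (trans (sym c≡e) (numeral-at c ω))) } }

  computed : ∀ h → (∀ A a → Holds (a , A) (h (a , A))) → ∃[ d ] ComputedBy 𝓐 d h
  computed h h-holds = realizer realizable , λ A a →
    subst (λ b → standardModel 𝓐 A f⟨ realizer realizable ⟩ (pair a b) ≡ true)
      (unique (a , A) (holds realizable (a , A) tt) (h-holds A a))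
      (at-graph (realizer realizable) a A)

graph-total : (𝓐 : ClassOfFunctionAlgebras) (d : Derivation 𝓐) →
              RA₁ 𝓐 ⊢ ∀′ (∃!′ (f⟨ d ⟩ ⦅ var 1F ⦆≐ var 0F))
graph-total 𝓐 d =
  ∀I (∃E (∀E (∧E₁ (ax (function d))) (var 0F))
    (∃I (var 0F) (∧I (hyp (here refl)) (∀I (⇒I
      (⇒E (∀E (∀E (∀E (∧E₁ (∧E₂ (ax (function d)))) (var 2F)) (var 0F)) (var 1F))
          (∧I (hyp (here refl)) (hyp (there (here refl))))))))))

theorem8p3 : (𝓐 : ClassOfFunctionAlgebras) (h : ℕ × 𝒫ℕ → ℕ) →
    ProvablyTotal 𝓐 h ⇔ (∃[ d ] ComputedBy 𝓐 d h)
theorem8p3 𝓐 h = mk⇔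
  (λ (φ , φ-Σ , φ-total , h-holds) → Extraction.computed 𝓐 φ-Σ φ-total h h-holds)
  (λ (d , h-computed) →
    f⟨ d ⟩ ⦅ var 1F ⦆≐ var 0F , bounded (_ ∈ₛ _) , graph-total 𝓐 d , h-computed)
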